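{- (1) If $C_1,C_2$ are circuits of a matroid $M$ and there is an automorphism $\varphi$ of $M$ with $\varphi(C_1)=C_2$, then $\beta_{C_1}=\beta_{C_2}$. In particular, if the automorphism group of $M$ acts transitively on the set of circuits of $M$, then $M$ is equitable. (2) There exists an equitable matroid $M$ whose automorphism group does not act transitively on the set of circuits of $M$. (3) Uniform matroids and duals of projective geometries over finite fields are equitable.
   Context: Matroid bingo: let $M$ be a matroid on a finite set $E$ with $|E|=n$ and circuit set $\mathcal{C}$. The elements of $E$ are called out one at a time in a uniformly random order $\sigma(1),\sigma(2),\dots,\sigma(n)$ (a uniformly random permutation of $E$). A circuit $C$ wins in round $t$ if $C\subseteq\{\sigma(1),\dots,\sigma(t)\}$ and no circuit of $M$ is contained in $\{\sigma(1),\dots,\sigma(t-1)\}$; thus the winner is the first circuit to be completed (the circuit axioms guarantee that there is no tie). $\beta_C$ denotes the probability that $C$ wins (in some round). A matroid $M$ is equitable if all circuits $C$ of $M$ have the same value of $\beta_C$. An automorphism of $M$ is a bijection of the ground set that induces a bijection of the set of circuits onto itself. The uniform matroid $U_{r,n}$ is the matroid on $\{1,\dots,n\}$ whose circuits are all subsets of size $r+1$. For a prime power $q$ and an integer $n\ge 0$, the projective geometry $\mathrm{PG}(n,q)$ is the matroid of rank $n+1$ whose ground set is the set of 1-dimensional subspaces of $\mathrm{GF}(q)^{n+1}$, a set of such subspaces being independent if and only if they are linearly independent in $\mathrm{GF}(q)^{n+1}$. The dual matroid $M^*$ of a matroid $M$ on $E$ is the matroid on $E$ whose bases are the complements $E\setminus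 B$ of the bases $B$ of $M$. -}

module Defs where

open import Algebra.Bundles using (CommutativeRing)
open import Data.Fin.Base using (Fin; toℕ)
open import Data.Fin.Permutation using (Permutation′; _⟨$⟩ˡ_)
open import Data.Fin.Properties as Fin using (any?)
open import Data.Fin.Subset
open import Data.Fin.Subset.Properties
open import Data.Integer.Base using (+_)
open import Data.List.Base as List using (List; []; _∷_; allFin; cartesianProductWith; filter; length)
import Data.List.Membership.Propositional as List
open import Data.List.Membership.Propositional.Properties
  using (∈-allFin; ∈-cartesianProductWith⁺; ∈-filter⁺; ∈-length)
open import Data.List.Relation.Unary.Any using (here)
open import Data.Nat.Base using (ℕ; zero; suc; NonZero; _≤_; z≤n; s≤s; >-nonZero)
open import Data.Nat.Properties as ℕ using (≤-refl; ≤-trans; ≤-reflexive; ≤-pred; _≟_)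
open import Data.Product.Base using (Σ-syntax; ∃; ∃-syntax; _×_; _,_; proj₁)
open import Data.Rational.Base using (ℚ; _/_)
open import Data.Vec.Base as Vec using (Vec; []; _∷_; lookup; tabulate; toList; here; there)
open import Data.Vec.Functional using (Vector)
open import Data.Vec.Relation.Unary.AllPairs using (allPairs?)
open import Data.Vec.Relation.Unary.Unique.Propositional using (Unique)
open import Data.Vec.Relation.Unary.Unique.Propositional.Properties using (tabulate⁺)
open import Function.Base using (id; _on_)
open import Function.Bundles using (Bijection; _⇔_)
open import Function.Definitions using (Bijective)
open import Level using (Level; 0ℓ; _⊔_) renaming (suc to lsuc)
open import Relation.Binary.Bundles using (Setoid)
open import Relation.Binary.Core using (Rel)
open import Relation.Binary.PropositionalEquality as ≡
  using (_≡_; _≢_; refl; sym; trans; cong)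
open import Relation.Nullary using (¬_; yes; no; contradiction)
open import Relation.Nullary.Decidable using (¬?; _×-dec_; decidable-stable)
open import Relation.Unary using (Pred; Decidable; _≐_)
import Relation.Unary.Properties as Unary

private
  variable
    n r q : ℕ
    c ℓ : Level

------------------------------------------------------------------------
-- Matroids

-- A finite ground set with n elements is identified with Fin n.  Decidability
-- of the circuit set is what lets the orders in which C wins be counted.

record Matroid (n : ℕ) : Set₁ where
  field
    Circuit     : Pred (Subset n) 0ℓ
    circuit?    : Decidable Circuit
    nonempty    : ¬ Circuit ⊥
    minimal     : ∀ {C₁ C₂} → Circuit C₁ → Circuit C₂ → C₁ ⊆ C₂ → C₁ ≡ C₂
    elimination : ∀ {C₁ C₂ e} → Circuit C₁ → Circuit C₂ → C₁ ≢ C₂ → e ∈ C₁ ∩ C₂ →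
                  ∃[ C₃ ] Circuit C₃ × C₃ ⊆ (C₁ ∪ C₂) - e

module _ (M : Matroid n) where
  open Matroid M

  Independent : Pred (Subset n) 0ℓ
  Independent S = ∀ {C} → Circuit C → C ⊈ S

  Basis : Pred (Subset n) 0ℓ
  Basis B = Independent B × (∀ {S} → Independent S → B ⊆ S → S ⊆ B)

IsDual : Matroid n → Matroid n → Set
IsDual M M* = ∀ B → Basis M* B ⇔ Basis M (∁ B)

------------------------------------------------------------------------
-- Matroid bingo

sequences : ∀ k → List (Vec (Fin n) k)
sequences zero    = [] ∷ []
sequences (suc k) = cartesianProductWith _∷_ (allFin _) (sequences k)

unique? : ∀ {k} → Decidable {A = Vec (Fin n) k} Unique
unique? = allPairs? λ i j → ¬? (i Fin.≟ j)

-- Each permutation of Fin n, given as the vector of its values, occurs once.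

orders : ∀ n → List (Vec (Fin n) n)
orders n = filter unique? (sequences n)

∈-sequences : ∀ {k} (v : Vec (Fin n) k) → v List.∈ sequences k
∈-sequences []      = here refl
∈-sequences (i ∷ v) = ∈-cartesianProductWith⁺ _∷_ (∈-allFin i) (∈-sequences v)

orders-nonZero : ∀ n → NonZero (length (orders n))
orders-nonZero n = >-nonZero (∈-length {xs = orders n}
  (∈-filter⁺ unique? (∈-sequences (tabulate id)) (tabulate⁺ id)))

probability : {P : Pred (Vec (Fin n) n) 0ℓ} → Decidable P → ℚ
probability {n} P? = + length (filter P? (orders n)) / length (orders n)
  where instance _ = orders-nonZero n

called : Vec (Fin n) n → ℕ → Subset n
called σ t = ⋃ (List.map ⁅_⁆ (List.take t (toList σ)))

module _ (M : Matroid n) where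
  open Matroid M

  -- t counts from 0, so t : Fin n stands for round t + 1.

  WinsInRound : Subset n → Vec (Fin n) n → Fin n → Set
  WinsInRound C σ t =
    C ⊆ called σ (suc (toℕ t)) × ¬ (∃[ D ] Circuit D × D ⊆ called σ (toℕ t))

  Wins : Subset n → Pred (Vec (Fin n) n) 0ℓ
  Wins C σ = ∃[ t ] WinsInRound C σ t

  wins? : ∀ C → Decidable (Wins C)
  wins? C σ = any? λ t →
    (C ⊆? called σ (suc (toℕ t))) ×-dec
    ¬? (anySubset? λ D → circuit? D ×-dec (D ⊆? called σ (toℕ t)))

  β : Subset n → ℚ
  β C = probability (wins? C)

  Equitable : Set
  Equitable = ∀ {C₁ C₂} → Circuit C₁ → Circuit C₂ → β C₁ ≡ β C₂

------------------------------------------------------------------------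
-- Automorphisms

image : Permutation′ n → Subset n → Subset n
image φ S = tabulate λ i → lookup S (φ ⟨$⟩ˡ i)

module _ (M : Matroid n) where
  open Matroid M

  _≡ᶜ_ : Rel (∃ Circuit) 0ℓ
  _≡ᶜ_ = _≡_ on proj₁

  record IsAutomorphism (φ : Permutation′ n) : Set where
    field
      preserves : ∀ {C} → Circuit C → Circuit (image φ C)
      bijective : Bijective _≡ᶜ_ _≡ᶜ_ λ (C , isC) → image φ C , preserves isC

  CircuitTransitive : Set
  CircuitTransitive = ∀ {C₁ C₂} → Circuit C₁ → Circuit C₂ →
    ∃[ φ ] IsAutomorphism φ × image φ C₁ ≡ C₂

------------------------------------------------------------------------
-- Uniform matroids

∃-⊆-ofSize : ∀ (S : Subset n) {k} → k ≤ ∣ S ∣ → ∃[ T ] ∣ T ∣ ≡ k × T ⊆ S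
∃-⊆-ofSize {n} S {zero} _ = ⊥ , ∣⊥∣≡0 n , ⊥⊆
∃-⊆-ofSize (inside ∷ S) {suc k} (s≤s k≤∣S∣) =
  let T , ∣T∣≡k , T⊆S = ∃-⊆-ofSize S k≤∣S∣
  in inside ∷ T , cong suc ∣T∣≡k , in⊆in T⊆S
∃-⊆-ofSize (outside ∷ S) {suc k} k<∣S∣ =
  let T , ∣T∣≡k , T⊆S = ∃-⊆-ofSize S k<∣S∣
  in outside ∷ T , ∣T∣≡k , out⊆ T⊆S

⊆∧∣∣≡⇒≡ : {S T : Subset n} → S ⊆ T → ∣ S ∣ ≡ ∣ T ∣ → S ≡ T
⊆∧∣∣≡⇒≡ {S = S} {T} S⊆T ∣S∣≡∣T∣ with any? (λ x → (x ∈? T) ×-dec ¬? (x ∈? S))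
... | yes S⊉T = contradiction ∣S∣≡∣T∣ (ℕ.<⇒≢ (p⊂q⇒∣p∣<∣q∣ (S⊆T , S⊉T)))
... | no ¬S⊉T = ⊆-antisym S⊆T λ {x} x∈T →
  decidable-stable (x ∈? S) λ x∉S → ¬S⊉T (x , x∈T , x∉S)

∣p∣≤1+∣p-x∣ : ∀ (p : Subset n) x → ∣ p ∣ ≤ suc ∣ p - x ∣
∣p∣≤1+∣p-x∣ (inside  ∷ p) Fin.zero    = s≤s (≤-reflexive (cong ∣_∣ (sym (p─⊥≡p p))))
∣p∣≤1+∣p-x∣ (outside ∷ p) Fin.zero    = ≤-trans (≤-reflexive (cong ∣_∣ (sym (p─⊥≡p p)))) (ℕ.n≤1+n _)
∣p∣≤1+∣p-x∣ (inside  ∷ p) (Fin.suc x) = s≤s (∣p∣≤1+∣p-x∣ p x)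
∣p∣≤1+∣p-x∣ (outside ∷ p) (Fin.suc x) = ∣p∣≤1+∣p-x∣ p x

-- For r ≥ n there are no circuits and U r n is the free matroid.

U : ∀ r n → Matroid n
U r n = record
  { Circuit     = λ C → ∣ C ∣ ≡ suc r
  ; circuit?    = λ C → ∣ C ∣ ≟ suc r
  ; nonempty    = λ ∣⊥∣≡1+r → contradiction (trans (sym ∣⊥∣≡1+r) (∣⊥∣≡0 n)) λ ()
  ; minimal     = λ c₁ c₂ C₁⊆C₂ → ⊆∧∣∣≡⇒≡ C₁⊆C₂ (trans c₁ (sym c₂))
  ; elimination = λ {C₁} {C₂} {e} c₁ c₂ C₁≢C₂ _ →
      ∃-⊆-ofSize ((C₁ ∪ C₂) - e)
        (≤-pred (≤-trans (large c₁ c₂ C₁≢C₂) (∣p∣≤1+∣p-x∣ (C₁ ∪ C₂) e)))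
  }
  where
  large : ∀ {C₁ C₂ : Subset n} → ∣ C₁ ∣ ≡ suc r → ∣ C₂ ∣ ≡ suc r → C₁ ≢ C₂ →
          suc (suc r) ≤ ∣ C₁ ∪ C₂ ∣
  large {C₁} {C₂} c₁ c₂ C₁≢C₂ = ℕ.≤∧≢⇒<
    (≤-trans (≤-reflexive (sym c₁)) (∣p∣≤∣p∪q∣ C₁ C₂))
    λ 1+r≡∣∪∣ → C₁≢C₂ (trans
      (⊆∧∣∣≡⇒≡ (p⊆p∪q C₂) (trans c₁ 1+r≡∣∪∣))
      (sym (⊆∧∣∣≡⇒≡ (q⊆p∪q C₁ C₂) (trans c₂ 1+r≡∣∪∣))))

------------------------------------------------------------------------
-- Projective geometries

record FiniteField (q : ℕ) c ℓ : Set (lsuc (c ⊔ ℓ)) where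
  field
    commutativeRing : CommutativeRing c ℓ
  open CommutativeRing commutativeRing public
  field
    1≉0         : ¬ 1# ≈ 0#
    inverse     : ∀ x → ¬ x ≈ 0# → ∃[ y ] x * y ≈ 1#
    enumeration : Bijection (≡.setoid (Fin q)) setoid

module _ (F : FiniteField q c ℓ) where
  open FiniteField F
  open import Algebra.Definitions.RawMonoid +-rawMonoid using (sum)

  infix  4 _≋_
  infixr 7 _·_

  _≋_ : ∀ {d} → Rel (Vector Carrier d) ℓ
  v ≋ w = ∀ j → v j ≈ w j

  0ᵥ : ∀ {d} → Vector Carrier d
  0ᵥ _ = 0#

  _·_ : ∀ {d} → Carrier → Vector Carrier d → Vector Carrier d
  (a · v) j = a * v j

  span : ∀ {d} → Vector Carrier d → Pred (Vector Carrier d) (c ⊔ ℓ)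
  span v w = ∃[ a ] w ≋ a · v

  -- A 1-dimensional subspace is given by a nonzero vector spanning it; two
  -- such vectors are identified when they span the same subspace.

  lines : ℕ → Setoid (c ⊔ ℓ) (c ⊔ ℓ)
  lines d = record
    { Carrier       = Σ[ v ∈ Vector Carrier d ] ¬ v ≋ 0ᵥ
    ; _≈_           = λ (v , _) (w , _) → span v ≐ span w
    ; isEquivalence = record
      { refl  = Unary.≐-refl
      ; sym   = Unary.≐-sym
      ; trans = Unary.≐-trans
      }
    }

  LinearlyIndependent : ∀ {d N} → (Fin N → Vector Carrier d) → Subset N → Set (c ⊔ ℓ)
  LinearlyIndependent {N = N} v S = (a : Fin N → Carrier) →
    (∀ {i} → i ∉ S → a i ≈ 0#) →
    (∀ j → sum (λ i → a i * v i j) ≈ 0#) →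
    ∀ i → a i ≈ 0#

  -- M is PG(n,q), its ground set being identified with the set of
  -- 1-dimensional subspaces by means of `points`.

  record IsProjectiveGeometry (n : ℕ) {N} (M : Matroid N) : Set (c ⊔ ℓ) where
    field
      points : Bijection (≡.setoid (Fin N)) (lines (suc n))

    generator : Fin N → Vector Carrier (suc n)
    generator i = proj₁ (Bijection.to points i)

    field
      independent : ∀ S → Independent M S ⇔ LinearlyIndependent generator S

{-# OPTIONS --safe #-}
module Submission where

open import Defs
import Algebra.Properties.CommutativeMonoid.Sum as CommutativeMonoidSum
import Algebra.Properties.CommutativeSemigroup as CommutativeSemigroupProperties
import Algebra.Properties.Ring as RingProperties
import Algebra.Properties.Semiring.Sum as SemiringSum
open import Data.Bool.Base using (if_then_else_)
import Data.Bool.Properties as Bool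
open import Data.Fin using (#_)
open import Data.Fin.Base using (Fin; zero; suc; toℕ; fromℕ; fromℕ<; inject₁; punchIn; punchOut)
open import Data.Fin.Permutation as Perm
  using (Permutation′; _⟨$⟩ʳ_; _⟨$⟩ˡ_; inverseˡ; inverseʳ; flip; permutation; insert; insert-punchIn)
open import Data.Fin.Properties as Fin
  using ( any?; all?; punchInᵢ≢i; punchOut-injective; injective⇒≤
        ; toℕ-fromℕ; toℕ-fromℕ<; toℕ-inject₁; toℕ-injective; toℕ<n)
open import Data.Fin.Subset
open import Data.Fin.Subset.Induction using (⊃-wellFounded)
open import Data.Fin.Subset.Properties
open import Data.Integer.Base using (+_)
open import Data.List.Base as List using (List; []; _∷_; filter; length)
import Data.List.Membership.Propositional as List
open import Data.List.Membership.Propositional using (find)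
open import Data.List.Membership.Propositional.Properties
  using (∈-filter⁺; ∈-filter⁻; ∈-map∘filter⁺; ∈-map∘filter⁻)
open import Data.List.Membership.Propositional.Properties.WithK using (unique∧set⇒bag)
open import Data.List.Properties using (length-map)
open import Data.List.Relation.Binary.BagAndSetEquality using (∼bag⇒↭)
open import Data.List.Relation.Binary.Permutation.Propositional.Properties using (↭-length)
open import Data.List.Relation.Unary.All as All using (All)
import Data.List.Relation.Unary.AllPairs as AllPairs
open import Data.List.Relation.Unary.Any as Any using (Any)
import Data.List.Relation.Unary.Unique.Propositional as List
import Data.List.Relation.Unary.Unique.Propositional.Properties as Listᵤ
open import Data.Nat.Base as ℕ using (ℕ; zero; suc; s≤s; z≤n)
import Data.Nat.Properties as ℕ
open import Data.Product.Base using (Σ-syntax; ∃-syntax; _×_; _,_; proj₁; proj₂)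
open import Data.Rational.Base using (_/_)
open import Data.Sum.Base using (_⊎_; inj₁; inj₂)
open import Data.Vec.Base as Vec using (Vec; []; _∷_; lookup; toList)
open import Data.Vec.Functional as Vector using (Vector; tail; removeAt)
open import Data.Vec.Properties
  using ( lookup∘tabulate; lookup-map; map-∘; map-cong; map-id; ∷-injective; ≡-dec
        ; []=⇒lookup; lookup⇒[]=)
open import Data.Vec.Relation.Unary.Unique.Propositional using (Unique)
import Data.Vec.Relation.Unary.Unique.Propositional.Properties as Vecᵤ
open import Function.Base using (_∘_; case_of_)
open import Function.Bundles using (Bijection; module Equivalence; mk⇔)
open import Function.Definitions using (Injective)
open import Induction.WellFounded using (Acc; acc)
open import Level using (0ℓ; _⊔_)
open import Relation.Binary.Definitions using (DecidableEquality)
import Relation.Binary.Definitions as Binary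
open import Relation.Binary.PropositionalEquality
  using (_≡_; _≢_; refl; sym; trans; cong; cong₂; subst; subst₂; module ≡-Reasoning)
open import Relation.Nullary using (¬_; Dec; yes; no; contradiction)
open import Relation.Nullary.Decidable
  using (¬?; _×-dec_; _⊎-dec_; _→-dec_; map′; from-yes; decidable-stable)
open import Relation.Unary using (Pred; Decidable; _≐_)

-- Relabelling the elements by a permutation φ permutes the orders, so β C₁ = β C₂
-- as soon as φ turns the orders in which C₁ wins into those in which C₂ wins.
-- This holds if φ preserves independence and maps C₁ onto C₂.  For the dual of
-- PG(n,q), whose circuits are the complements of hyperplanes, φ comes from a
-- linear map carrying one functional to the other.
--
-- In the dual of a simple matroid of rank 3, the complement of a line wins
-- exactly when the last two points called lie on the line.  If all lines have
-- the same size, any permutation matching two lines therefore shows that their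
-- complements are equally likely to win, whereas an automorphism has to preserve
-- all lines.  One of the two Steiner triple systems on 13 points has both lines
-- in a Pasch configuration and lines in none.

-- `IsDual` gives access to `M*` only through bases, so the description of its circuits as
-- complements of hyperplanes has to be derived. No notion of rank or dimension is set up for this:
-- `annihilator⊎spans` settles by elimination whether the vectors of a set lie in a hyperplane, and
-- maximal independent sets do the rest. The linear map is `v ↦ v + k(v) u` for a single `u` on
-- which neither functional vanishes. Exchanging the functionals gives its inverse, so no basis has
-- to be completed and no matrix inverted. Thirteen is the first order at which transitivity on
-- blocks can fail: the Steiner triple systems on 3, 7 and 9 points are a single block, the Fano
-- plane and the affine plane of order 3. In the cyclic system on 13 points, 014, 027, 179, 249 and
-- its translates put every block in a Pasch configuration, since 014 and 027 are the base blocks.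
-- The existence of a Pasch configuration can tell blocks apart only after the trade.

private
  variable
    n : ℕ

-- Subsets

∁-involutive : ∀ (S : Subset n) → ∁ (∁ S) ≡ S
∁-involutive S = ⊆-antisym
  (λ i∈ → x∉∁p⇒x∈p (x∈∁p⇒x∉p i∈)) (λ i∈ → x∉p⇒x∈∁p (x∈p⇒x∉∁p i∈))

∁-injective : ∀ {S T : Subset n} → ∁ S ≡ ∁ T → S ≡ T
∁-injective {S = S} {T} eq = trans (sym (∁-involutive S)) (trans (cong ∁ eq) (∁-involutive T))

∁⊥≡⊤ : ∁ ⊥ ≡ ⊤ {n}
∁⊥≡⊤ = ⊆-antisym ⊆⊤ (λ _ → x∉p⇒x∈∁p ∉⊥)

module _ (φ : Permutation′ n) where

  ∈-image⁺ : ∀ S {i} → φ ⟨$⟩ˡ i ∈ S → i ∈ image φ S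
  ∈-image⁺ S {i} i∈S = lookup⇒[]= i (image φ S)
    (trans (lookup∘tabulate _ i) ([]=⇒lookup i∈S))

  ∈-image⁻ : ∀ S {i} → i ∈ image φ S → φ ⟨$⟩ˡ i ∈ S
  ∈-image⁻ S {i} i∈φS = lookup⇒[]= (φ ⟨$⟩ˡ i) S
    (trans (sym (lookup∘tabulate _ i)) ([]=⇒lookup i∈φS))

  ∈-image-ʳ⁺ : ∀ S {i} → i ∈ S → φ ⟨$⟩ʳ i ∈ image φ S
  ∈-image-ʳ⁺ S i∈S = ∈-image⁺ S (subst (_∈ S) (sym (inverseˡ φ)) i∈S)

  ∈-image-ʳ⁻ : ∀ S {i} → φ ⟨$⟩ʳ i ∈ image φ S → i ∈ S
  ∈-image-ʳ⁻ S i∈S = subst (_∈ S) (inverseˡ φ) (∈-image⁻ S i∈S)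

  image-⊆⁺ : ∀ {S T} → S ⊆ T → image φ S ⊆ image φ T
  image-⊆⁺ {S} {T} S⊆T = ∈-image⁺ T ∘ S⊆T ∘ ∈-image⁻ S

  image-⊆⁻ : ∀ {S T} → image φ S ⊆ image φ T → S ⊆ T
  image-⊆⁻ {S} {T} φS⊆φT = ∈-image-ʳ⁻ T ∘ φS⊆φT ∘ ∈-image-ʳ⁺ S

  image-injective : ∀ {S T} → image φ S ≡ image φ T → S ≡ T
  image-injective {S} {T} eq = ⊆-antisym
    (image-⊆⁻ {S} {T} (⊆-reflexive eq)) (image-⊆⁻ {T} {S} (⊆-reflexive (sym eq)))

image-flip : ∀ (φ : Permutation′ n) S → image (flip φ) (image φ S) ≡ S
image-flip φ S = ⊆-antisym
  (∈-image-ʳ⁻ φ S ∘ ∈-image⁻ (flip φ) (image φ S))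
  (∈-image⁺ (flip φ) (image φ S) ∘ ∈-image-ʳ⁺ φ S)

image-∁ : ∀ (φ : Permutation′ n) S → image φ (∁ S) ≡ ∁ (image φ S)
image-∁ φ S = ⊆-antisym
  (λ i∈ → x∉p⇒x∈∁p (x∈∁p⇒x∉p (∈-image⁻ φ (∁ S) i∈) ∘ ∈-image⁻ φ S))
  (λ i∈ → ∈-image⁺ φ (∁ S) (x∉p⇒x∈∁p (x∈∁p⇒x∉p i∈ ∘ ∈-image⁺ φ S)))

image-∩ : ∀ (φ : Permutation′ n) S T → image φ (S ∩ T) ≡ image φ S ∩ image φ T
image-∩ φ S T = ⊆-antisym
  (λ i∈ → let i∈S , i∈T = x∈p∩q⁻ S T (∈-image⁻ φ (S ∩ T) i∈)
          in x∈p∩q⁺ (∈-image⁺ φ S i∈S , ∈-image⁺ φ T i∈T))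
  (λ i∈ → let i∈S , i∈T = x∈p∩q⁻ (image φ S) (image φ T) i∈
          in ∈-image⁺ φ (S ∩ T) (x∈p∩q⁺ (∈-image⁻ φ S i∈S , ∈-image⁻ φ T i∈T)))

indicator : Side → ℕ
indicator s = if s then 1 else 0

∣S∣≡sum : ∀ (S : Subset n) →
          ∣ S ∣ ≡ Vector.foldr ℕ._+_ 0 (λ i → indicator (lookup S i))
∣S∣≡sum []            = refl
∣S∣≡sum (inside  ∷ S) = cong suc (∣S∣≡sum S)
∣S∣≡sum (outside ∷ S) = ∣S∣≡sum S

∣image∣ : ∀ (φ : Permutation′ n) S → ∣ image φ S ∣ ≡ ∣ S ∣
∣image∣ φ S = begin
  ∣ image φ S ∣
    ≡⟨ ∣S∣≡sum (image φ S) ⟩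
  Vector.foldr ℕ._+_ 0 (λ i → indicator (lookup (image φ S) i))
    ≡⟨ sum-permute _ φ ⟩
  Vector.foldr ℕ._+_ 0 (λ i → indicator (lookup (image φ S) (φ ⟨$⟩ʳ i)))
    ≡⟨ sum-cong-≗ (cong indicator ∘ lookup-image-ʳ) ⟩
  Vector.foldr ℕ._+_ 0 (λ i → indicator (lookup S i))
    ≡⟨ ∣S∣≡sum S ⟨
  ∣ S ∣ ∎
  where
  open ≡-Reasoning
  open CommutativeMonoidSum ℕ.+-0-commutativeMonoid using (sum-permute; sum-cong-≗)
  lookup-image-ʳ : ∀ i → lookup (image φ S) (φ ⟨$⟩ʳ i) ≡ lookup S i
  lookup-image-ʳ i = trans (lookup∘tabulate _ (φ ⟨$⟩ʳ i)) (cong (lookup S) (inverseˡ φ))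

-- This supplies a partner for the head when `S` and `T` are matched entry by entry. For an outside
-- head, `T` has a gap because its size is at most `n` while it has `suc n` entries.
∃-lookup : ∀ (S : Subset n) (T : Subset (suc n)) s → ∣ s ∷ S ∣ ≡ ∣ T ∣ → ∃[ j ] lookup T j ≡ s
∃-lookup {n = n} S T inside eq with nonempty? T
... | yes (j , j∈T) = j , []=⇒lookup j∈T
... | no T-empty = contradiction
  (trans eq (trans (cong ∣_∣ (Empty-unique T-empty)) (∣⊥∣≡0 (suc n)))) λ ()
∃-lookup S T outside eq with nonempty? (∁ T)
... | yes (j , j∈∁T) = j , outside-lookup T j (x∈∁p⇒x∉p j∈∁T)
  where
  outside-lookup : ∀ (T : Subset n) j → j ∉ T → lookup T j ≡ outside
  outside-lookup T j j∉T with lookup T j in eq′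
  ... | inside  = contradiction (lookup⇒[]= j T eq′) j∉T
  ... | outside = refl
∃-lookup {n = n} S T outside eq | no ∁T-empty = contradiction
  (trans eq (trans (cong ∣_∣ (sym ⊤≡T)) (∣⊤∣≡n _))) (ℕ.<⇒≢ (s≤s (∣p∣≤n S)))
  where
  ⊤≡T : ⊤ ≡ T
  ⊤≡T = ⊆-antisym (λ {x} _ → x∉∁p⇒x∈p λ x∈∁T → ∁T-empty (x , x∈∁T)) ⊆⊤

∣removeAt∣ : ∀ (S : Subset (suc n)) j → ∣ lookup S j ∷ Vec.removeAt S j ∣ ≡ ∣ S ∣
∣removeAt∣ (s ∷ S) zero = refl
∣removeAt∣ (inside  ∷ S@(_ ∷ _)) (suc j) with lookup S j | ∣removeAt∣ S j
... | inside  | eq = cong suc eq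
... | outside | eq = cong suc eq
∣removeAt∣ (outside ∷ S@(_ ∷ _)) (suc j) with lookup S j | ∣removeAt∣ S j
... | inside  | eq = eq
... | outside | eq = eq

∣∷∣-cancel : ∀ s {S T : Subset n} → ∣ s ∷ S ∣ ≡ ∣ s ∷ T ∣ → ∣ S ∣ ≡ ∣ T ∣
∣∷∣-cancel inside  eq = ℕ.suc-injective eq
∣∷∣-cancel outside eq = eq

lookup-removeAt : ∀ (S : Subset (suc n)) j k →
                  lookup (Vec.removeAt S j) k ≡ lookup S (punchIn j k)
lookup-removeAt (s ∷ S)         zero    k       = refl
lookup-removeAt (s ∷ S@(_ ∷ _)) (suc j) zero    = refl
lookup-removeAt (s ∷ S@(_ ∷ _)) (suc j) (suc k) = lookup-removeAt S j k

-- Induction: the head of `S` is matched with some `j`, both entries are deleted, and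
-- `insert zero j` extends the permutation of the rest. Moving entry `j` of `T` to the front keeps
-- the size, so the remainders again have equal size.
∣∣≡⇒∃-lookup : ∀ (S T : Subset n) → ∣ S ∣ ≡ ∣ T ∣ →
               ∃[ φ ] ∀ i → lookup T (φ ⟨$⟩ʳ i) ≡ lookup S i
∣∣≡⇒∃-lookup []      []         _  = Perm.id , λ ()
∣∣≡⇒∃-lookup {suc n} (s ∷ S) T eq with ∃-lookup S T s eq
... | j , refl with ∣∣≡⇒∃-lookup S (Vec.removeAt T j)
                      (∣∷∣-cancel s {S} {Vec.removeAt T j} (trans eq (sym (∣removeAt∣ T j))))
... | φ , φ-lookup = insert zero j φ , λ where
  zero    → refl
  (suc k) → trans (cong (lookup T) (insert-punchIn zero j φ k))
           (trans (sym (lookup-removeAt T j (φ ⟨$⟩ʳ k))) (φ-lookup k))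

∣∣≡⇒∃-image : ∀ (S T : Subset n) → ∣ S ∣ ≡ ∣ T ∣ → ∃[ φ ] image φ S ≡ T
∣∣≡⇒∃-image S T eq =
  let φ , φ-lookup = ∣∣≡⇒∃-lookup S T eq
      lookup-φ : ∀ i → lookup S (φ ⟨$⟩ˡ i) ≡ lookup T i
      lookup-φ i = trans (sym (φ-lookup (φ ⟨$⟩ˡ i))) (cong (lookup T) (inverseʳ φ))
  in φ , ⊆-antisym
    (λ {i} i∈ → lookup⇒[]= i T (trans (sym (lookup-φ i)) ([]=⇒lookup (∈-image⁻ φ S i∈))))
    (λ {i} i∈ → ∈-image⁺ φ S (lookup⇒[]= _ S (trans (lookup-φ i) ([]=⇒lookup i∈))))

-- Relabelling

-- `called` appears unfolded because the induction needs a length `m` that varies independently of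
-- `n`.
∈-called⁺ : ∀ {m} (σ : Vec (Fin n) m) t i → toℕ i ℕ.< t →
            lookup σ i ∈ ⋃ (List.map ⁅_⁆ (List.take t (toList σ)))
∈-called⁺ (x ∷ σ) (suc t) zero    _         = x∈p∪q⁺ (inj₁ (x∈⁅x⁆ x))
∈-called⁺ (x ∷ σ) (suc t) (suc i) (s≤s i<t) = x∈p∪q⁺ (inj₂ (∈-called⁺ σ t i i<t))

∈-called⁻ : ∀ {m} (σ : Vec (Fin n) m) t {x} →
            x ∈ ⋃ (List.map ⁅_⁆ (List.take t (toList σ))) →
            ∃[ i ] toℕ i ℕ.< t × lookup σ i ≡ x
∈-called⁻ []      zero    x∈ = contradiction x∈ ∉⊥
∈-called⁻ []      (suc t) x∈ = contradiction x∈ ∉⊥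
∈-called⁻ (_ ∷ _) zero    x∈ = contradiction x∈ ∉⊥
∈-called⁻ (y ∷ σ) (suc t) x∈ with x∈p∪q⁻ ⁅ y ⁆ _ x∈
... | inj₁ x∈⁅y⁆ = zero , s≤s z≤n , sym (x∈⁅y⁆⇒x≡y y x∈⁅y⁆)
... | inj₂ x∈σ   =
  let i , i<t , eq = ∈-called⁻ σ t x∈σ in suc i , s≤s i<t , eq

called-mono : ∀ (σ : Vec (Fin n) n) {s t} → s ℕ.≤ t → called σ s ⊆ called σ t
called-mono σ {s} {t} s≤t x∈ =
  let i , i<s , eq = ∈-called⁻ σ s x∈
  in subst (_∈ called σ t) eq (∈-called⁺ σ t i (ℕ.<-≤-trans i<s s≤t))

called-map : ∀ (φ : Permutation′ n) σ t →
             called (Vec.map (φ ⟨$⟩ʳ_) σ) t ≡ image φ (called σ t)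
called-map φ σ t = ⊆-antisym
  (λ x∈ → let i , i<t , eq = ∈-called⁻ (Vec.map (φ ⟨$⟩ʳ_) σ) t x∈
          in subst (_∈ image φ (called σ t)) (trans (sym (lookup-map i _ σ)) eq)
               (∈-image-ʳ⁺ φ (called σ t) (∈-called⁺ σ t i i<t)))
  (λ {x} x∈ →
    let i , i<t , eq = ∈-called⁻ σ t (∈-image⁻ φ (called σ t) x∈)
    in subst (_∈ called (Vec.map (φ ⟨$⟩ʳ_) σ) t)
         (trans (lookup-map i _ σ) (trans (cong (φ ⟨$⟩ʳ_) eq) (inverseʳ φ)))
         (∈-called⁺ (Vec.map (φ ⟨$⟩ʳ_) σ) t i i<t))

sequences-unique : ∀ k → List.Unique (sequences {n} k)
sequences-unique zero    = All.[] AllPairs.∷ AllPairs.[]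
sequences-unique (suc k) =
  Listᵤ.cartesianProductWith⁺ _∷_ ∷-injective (Listᵤ.allFin⁺ _) (sequences-unique k)

orders-unique : List.Unique (orders n)
orders-unique {n} = Listᵤ.filter⁺ unique? (sequences-unique n)

∈-orders⁺ : ∀ {σ : Vec (Fin n) n} → Unique σ → σ List.∈ orders n
∈-orders⁺ {σ = σ} = ∈-filter⁺ unique? (∈-sequences σ)

∈-orders⁻ : ∀ {σ : Vec (Fin n) n} → σ List.∈ orders n → Unique σ
∈-orders⁻ {n} = proj₂ ∘ ∈-filter⁻ unique? {xs = sequences n}

module _ (φ : Permutation′ n) where

  ⟨$⟩ʳ-injective : ∀ {i j} → φ ⟨$⟩ʳ i ≡ φ ⟨$⟩ʳ j → i ≡ j
  ⟨$⟩ʳ-injective eq = trans (sym (inverseˡ φ)) (trans (cong (φ ⟨$⟩ˡ_) eq) (inverseˡ φ))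

  map-flip : ∀ {m} (σ : Vec (Fin n) m) →
             Vec.map (φ ⟨$⟩ˡ_) (Vec.map (φ ⟨$⟩ʳ_) σ) ≡ σ
  map-flip σ = trans (sym (map-∘ _ _ σ)) (trans (map-cong (λ _ → inverseˡ φ) σ) (map-id σ))

-- Both lists of winning orders are free of duplicates, so having the same members after relabelling
-- makes them permutations of each other, hence equally long. Only wins of `C₁` and `C₂` are
-- compared, which leaves room for a `φ` that does not respect the matroid, as in `β-image`.
β-relabel : ∀ (M : Matroid n) (φ : Permutation′ n) {C₁ C₂} →
            (∀ {σ} → Unique σ → Wins M C₁ σ → Wins M C₂ (Vec.map (φ ⟨$⟩ʳ_) σ)) →
            (∀ {σ} → Unique σ → Wins M C₂ (Vec.map (φ ⟨$⟩ʳ_) σ) → Wins M C₁ σ) →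
            β M C₁ ≡ β M C₂
β-relabel {n} M φ {C₁} {C₂} wins⁺ wins⁻ =
  cong (λ k → (+ k / length (orders n)) ⦃ orders-nonZero n ⦄) (begin
    length (filter (wins? M C₁) (orders n))
      ≡⟨ length-map relabel (filter (wins? M C₁) (orders n)) ⟨
    length (List.map relabel (filter (wins? M C₁) (orders n)))
      ≡⟨ ↭-length (∼bag⇒↭ (unique∧set⇒bag
           (Listᵤ.map⁺ relabel-injective (Listᵤ.filter⁺ (wins? M C₁) orders-unique))
           (Listᵤ.filter⁺ (wins? M C₂) orders-unique)
           (mk⇔ to from))) ⟩
    length (filter (wins? M C₂) (orders n)) ∎)
  where
  open ≡-Reasoning
  relabel : Vec (Fin n) n → Vec (Fin n) n
  relabel = Vec.map (φ ⟨$⟩ʳ_)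

  relabel-injective : ∀ {σ τ} → relabel σ ≡ relabel τ → σ ≡ τ
  relabel-injective eq =
    trans (sym (map-flip φ _)) (trans (cong (Vec.map (φ ⟨$⟩ˡ_)) eq) (map-flip φ _))

  to : ∀ {τ} → τ List.∈ List.map relabel (filter (wins? M C₁) (orders n)) →
       τ List.∈ filter (wins? M C₂) (orders n)
  to τ∈ =
    let σ , σ∈ , eq , wins = ∈-map∘filter⁻ relabel (wins? M C₁) {xs = orders n} τ∈
        σ-unique = ∈-orders⁻ σ∈
    in subst (List._∈ filter (wins? M C₂) (orders n)) (sym eq)
         (∈-filter⁺ (wins? M C₂)
           (∈-orders⁺ (Vecᵤ.map⁺ (⟨$⟩ʳ-injective φ) σ-unique)) (wins⁺ σ-unique wins))

  from : ∀ {τ} → τ List.∈ filter (wins? M C₂) (orders n) →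
         τ List.∈ List.map relabel (filter (wins? M C₁) (orders n))
  from {τ} τ∈ =
    let τ∈orders , wins = ∈-filter⁻ (wins? M C₂) {xs = orders n} τ∈
        σ-unique = Vecᵤ.map⁺ (⟨$⟩ʳ-injective (flip φ)) (∈-orders⁻ τ∈orders)
    in ∈-map∘filter⁺ relabel (wins? M C₁)
         ( Vec.map (φ ⟨$⟩ˡ_) τ , ∈-orders⁺ σ-unique , sym (map-flip (flip φ) τ)
         , wins⁻ σ-unique (subst (Wins M C₂) (sym (map-flip (flip φ) τ)) wins))

-- Besides `C` itself, a win involves only the independence of the set called before. Independence,
-- moreover, passes to a dual by way of bases.
record PreservesIndependence (M : Matroid n) (φ : Permutation′ n) : Set where
  field
    image⁺ : ∀ {S} → Independent M S → Independent M (image φ S)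
    image⁻ : ∀ {S} → Independent M (image φ S) → Independent M S

open PreservesIndependence

preserves⇒β : ∀ {M : Matroid n} {φ} → PreservesIndependence M φ →
              ∀ C → β M C ≡ β M (image φ C)
preserves⇒β {M = M} {φ} pres C = β-relabel M φ
  (λ {σ} _ (t , C⊆ , ind) → t ,
    subst (image φ C ⊆_) (sym (called-map φ σ (suc (toℕ t)))) (image-⊆⁺ φ C⊆) ,
    λ (D , d , D⊆) →
      image⁺ pres {called σ (toℕ t)} (λ {D} d D⊆ → ind (D , d , D⊆)) d
        (subst (D ⊆_) (called-map φ σ (toℕ t)) D⊆))
  (λ {σ} _ (t , C⊆ , ind) → t ,
    image-⊆⁻ φ (subst (image φ C ⊆_) (called-map φ σ (suc (toℕ t))) C⊆) ,
    λ (D , d , D⊆) →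
      image⁻ pres {called σ (toℕ t)}
        (λ {D} d D⊆ → ind (D , d , subst (D ⊆_) (sym (called-map φ σ (toℕ t))) D⊆))
        d D⊆)

automorphism-preserves : ∀ {M : Matroid n} {φ} → IsAutomorphism M φ → PreservesIndependence M φ
automorphism-preserves {M = M} {φ} aut = record
  { image⁺ = λ {S} ind {D} d D⊆φS →
      -- Surjectivity on circuits: `D` is the image of a circuit `C`, which then lies in `S`.
      let (C , c) , eq = proj₂ bijective (D , d)
      in ind c (image-⊆⁻ φ {C} {S} (subst (_⊆ image φ S) (sym (eq {C , c} refl)) D⊆φS))
  ; image⁻ = λ {S} ind {D} d D⊆S → ind (preserves d) (image-⊆⁺ φ {D} {S} D⊆S)
  }
  where open IsAutomorphism aut

automorphism⇒β : ∀ (M : Matroid n) {C₁ C₂} φ → IsAutomorphism M φ → image φ C₁ ≡ C₂ →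
                 β M C₁ ≡ β M C₂
automorphism⇒β M {C₁} φ aut eq =
  trans (preserves⇒β (automorphism-preserves aut) C₁) (cong (β M) eq)

transitive⇒equitable : ∀ (M : Matroid n) → CircuitTransitive M → Equitable M
transitive⇒equitable M transitive c₁ c₂ =
  let φ , aut , eq = transitive c₁ c₂ in automorphism⇒β M φ aut eq

uniform-preserves : ∀ r (φ : Permutation′ n) → PreservesIndependence (U r n) φ
uniform-preserves r φ = record
  { image⁺ = λ {S} ind {D} d D⊆φS → ind (trans (∣image∣ (flip φ) D) d)
      (subst (image (flip φ) D ⊆_) (image-flip φ S)
        (image-⊆⁺ (flip φ) {D} {image φ S} D⊆φS))
  ; image⁻ = λ {S} ind {D} d D⊆S → ind (trans (∣image∣ φ D) d) (image-⊆⁺ φ {D} {S} D⊆S)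
  }

uniform-equitable : ∀ r n → Equitable (U r n)
uniform-equitable r n {C₁} {C₂} c₁ c₂ =
  let φ , eq = ∣∣≡⇒∃-image C₁ C₂ (trans c₁ (sym c₂))
  in trans (preserves⇒β (uniform-preserves r φ) C₁) (cong (β (U r n)) eq)

-- Bases

∪⁅⁆⊆ : ∀ {B S : Subset n} {i} → B ⊆ S → i ∈ S → B ∪ ⁅ i ⁆ ⊆ S
∪⁅⁆⊆ {B = B} {S} {i} B⊆S i∈S x∈ with x∈p∪q⁻ B ⁅ i ⁆ x∈
... | inj₁ x∈B = B⊆S x∈B
... | inj₂ x∈⁅i⁆ = subst (_∈ S) (sym (x∈⁅y⁆⇒x≡y i x∈⁅i⁆)) i∈S

module _ (M : Matroid n) where
  open Matroid M

  independent-⊆ : ∀ {S T} → S ⊆ T → Independent M T → Independent M S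
  independent-⊆ S⊆T ind d D⊆S = ind d (S⊆T ∘ D⊆S)

  independent⊎⊇circuit : ∀ S → Independent M S ⊎ ∃[ D ] Circuit D × D ⊆ S
  independent⊎⊇circuit S with anySubset? (λ D → circuit? D ×-dec D ⊆? S)
  ... | yes ∃D = inj₂ ∃D
  ... | no ∄D = inj₁ λ d D⊆S → ∄D (_ , d , D⊆S)

  independent? : ∀ S → Dec (Independent M S)
  independent? S with independent⊎⊇circuit S
  ... | inj₁ ind = yes ind
  ... | inj₂ (D , d , D⊆S) = no λ ind → ind d D⊆S

  -- Maximality is tested on single elements, which a finite search can decide. Since subsets of
  -- independent sets are independent, this amounts to maximality among all independent subsets of
  -- `X`.
  record MaximalIn (X B : Subset n) : Set where
    field
      ⊆X      : B ⊆ X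
      indep   : Independent M B
      maximal : ∀ {i} → i ∈ X → Independent M (B ∪ ⁅ i ⁆) → i ∈ B

  extend : ∀ {S X} → Acc _⊃_ S → S ⊆ X → Independent M S → ∃[ B ] S ⊆ B × MaximalIn X B
  extend {S} {X} (acc rec) S⊆X ind
    with any? (λ i → i ∈? X ×-dec ¬? (i ∈? S) ×-dec independent? (S ∪ ⁅ i ⁆))
  ... | no ∄i = S , ⊆-refl , record
    { ⊆X      = S⊆X
    ; indep   = ind
    ; maximal = λ {i} i∈X ind′ →
        decidable-stable (i ∈? S) λ i∉S → ∄i (i , i∈X , i∉S , ind′)
    }
  ... | yes (i , i∈X , i∉S , ind′) =
    let B , S∪i⊆B , max = extend
          (rec (p⊆p∪q ⁅ i ⁆ , i , x∈p∪q⁺ (inj₂ (x∈⁅x⁆ i)) , i∉S))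
          (∪⁅⁆⊆ {B = S} {X} S⊆X i∈X) ind′
    in B , S∪i⊆B ∘ p⊆p∪q ⁅ i ⁆ , max

  independent⇒⊆maximal : ∀ {S X} → S ⊆ X → Independent M S → ∃[ B ] S ⊆ B × MaximalIn X B
  independent⇒⊆maximal = extend (⊃-wellFounded _)

  independent⇒⊆basis : ∀ {S} → Independent M S → ∃[ B ] S ⊆ B × Basis M B
  independent⇒⊆basis ind =
    let B , S⊆B , max = independent⇒⊆maximal ⊆⊤ ind
        open MaximalIn max
    in B , S⊆B , indep , λ {T} indT B⊆T i∈T →
         maximal ∈⊤ (independent-⊆ (∪⁅⁆⊆ {B = B} {T} B⊆T i∈T) indT)

preserves-flip : ∀ {M : Matroid n} {φ} → PreservesIndependence M φ → PreservesIndependence M (flip φ)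
preserves-flip {M = M} {φ} pres = record
  { image⁺ = λ {S} ind → image⁻ pres {image (flip φ) S}
      (subst (Independent M) (sym (image-flip (flip φ) S)) ind)
  ; image⁻ = λ {S} ind → subst (Independent M) (image-flip (flip φ) S)
      (image⁺ pres {image (flip φ) S} ind)
  }

basis-image : ∀ {M : Matroid n} {φ} → PreservesIndependence M φ →
              ∀ {B} → Basis M B → Basis M (image φ B)
basis-image {M = M} {φ} pres {B} (ind , max) =
  image⁺ pres {B} ind , λ {S} indS φB⊆S →
    subst (_⊆ image φ B) (image-flip (flip φ) S) (image-⊆⁺ φ {image (flip φ) S} {B}
      (max (image⁺ (preserves-flip pres) {S} indS)
        (subst (_⊆ image (flip φ) S) (image-flip φ B)
          (image-⊆⁺ (flip φ) {image φ B} {S} φB⊆S))))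

module _ {M M* : Matroid n} (dual : IsDual M M*) where

  -- An independent set of `M*` extends to a basis, whose complement is a basis of `M`. That
  -- complement can be moved by `φ`, and images commute with complements.
  dual-image⁺ : ∀ {φ} → PreservesIndependence M φ →
                ∀ {S} → Independent M* S → Independent M* (image φ S)
  dual-image⁺ {φ} pres {S} ind =
    let B , S⊆B , basis = independent⇒⊆basis M* ind
        φB-basis = Equivalence.from (dual (image φ B))
          (subst (Basis M) (image-∁ φ B)
            (basis-image pres {∁ B} (Equivalence.to (dual B) basis)))
    in independent-⊆ M* (image-⊆⁺ φ {S} {B} S⊆B) (proj₁ φB-basis)

  dual-preserves : ∀ {φ} → PreservesIndependence M φ → PreservesIndependence M* φ
  dual-preserves {φ} pres = record
    { image⁺ = λ {S} → dual-image⁺ pres {S}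
    ; image⁻ = λ {S} ind → subst (Independent M*) (image-flip φ S)
        (dual-image⁺ (preserves-flip pres) {image φ S} ind)
    }

-- Linear algebra over a finite field

module LinearAlgebra {q c ℓ} (F : FiniteField q c ℓ) where
  open FiniteField F hiding (zero; _-_)
    renaming (refl to ≈-refl; sym to ≈-sym; trans to ≈-trans)
  open SemiringSum semiring
  open RingProperties ring using (-‿distribˡ-*)
  open CommutativeSemigroupProperties *-commutativeSemigroup
    using () renaming (x∙yz≈y∙xz to x*[y*z]≈y*[x*z])
  open import Relation.Binary.Reasoning.Setoid setoid

  infix 4 _≈?_
  -- Elements are compared through their indices in the enumeration. The search for pivots and the
  -- appeals to `decidable-stable` rest on this.
  _≈?_ : Binary.Decidable _≈_
  x ≈? y = map′ index⁻ index⁺ (index x Fin.≟ index y)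
    where
    open Bijection enumeration using (to; surjective; injective) renaming (cong to to-cong)

    index : Carrier → Fin q
    index = proj₁ ∘ surjective

    to-index : ∀ x → to (index x) ≈ x
    to-index x = proj₂ (surjective x) refl

    index⁻ : index x ≡ index y → x ≈ y
    index⁻ eq = ≈-trans (≈-sym (to-index x)) (≈-trans (to-cong eq) (to-index y))

    index⁺ : x ≈ y → index x ≡ index y
    index⁺ x≈y = injective (≈-trans (to-index x) (≈-trans x≈y (≈-sym (to-index y))))

  *-cancelʳ-0 : ∀ {x y} → ¬ y ≈ 0# → x * y ≈ 0# → x ≈ 0#
  *-cancelʳ-0 {x} {y} y≉0 xy≈0 = let z , yz≈1 = inverse y y≉0 in begin
    x           ≈⟨ *-identityʳ x ⟨
    x * 1#      ≈⟨ *-congˡ yz≈1 ⟨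
    x * (y * z) ≈⟨ *-assoc x y z ⟨
    x * y * z   ≈⟨ *-congʳ xy≈0 ⟩
    0# * z      ≈⟨ zeroˡ z ⟩
    0#          ∎

  -x≈0⇒x≈0 : ∀ {x} → - x ≈ 0# → x ≈ 0#
  -x≈0⇒x≈0 {x} -x≈0 = begin
    x       ≈⟨ +-identityʳ x ⟨
    x + 0#  ≈⟨ +-congˡ -x≈0 ⟨
    x + - x ≈⟨ -‿inverseʳ x ⟩
    0#      ∎

  x+[y-x]≈y : ∀ x y → x + (y + - x) ≈ y
  x+[y-x]≈y x y = begin
    x + (y + - x)   ≈⟨ +-congˡ (+-comm y (- x)) ⟩
    x + (- x + y) ≈⟨ +-assoc x (- x) y ⟨
    x + - x + y   ≈⟨ +-congʳ (-‿inverseʳ x) ⟩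
    0# + y        ≈⟨ +-identityˡ y ⟩
    y             ∎

  sum-zero : ∀ {N} {x : Vector Carrier N} → (∀ i → x i ≈ 0#) → sum x ≈ 0#
  sum-zero {N} x≈0 = ≈-trans (sum-cong-≋ x≈0) (sum-replicate-zero N)

  sum-single : ∀ {N} {x : Vector Carrier N} s → (∀ i → i ≢ s → x i ≈ 0#) → sum x ≈ x s
  sum-single {suc N} {x} s others = begin
    sum x                        ≈⟨ sum-remove {i = s} x ⟩
    x s + sum (removeAt x s)     ≈⟨ +-congˡ (sum-zero λ i → others (punchIn s i) (punchInᵢ≢i s i)) ⟩
    x s + 0#                     ≈⟨ +-identityʳ (x s) ⟩
    x s                          ∎

  δ : ∀ {N} → Fin N → Vector Carrier N
  δ s i with i Fin.≟ s
  ... | yes _ = 1#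
  ... | no  _ = 0#

  δ-diag : ∀ {N} (s : Fin N) → δ s s ≈ 1#
  δ-diag s with s Fin.≟ s
  ... | yes _ = ≈-refl
  ... | no s≢s = contradiction refl s≢s

  δ-off : ∀ {N} {s i : Fin N} → i ≢ s → δ s i ≈ 0#
  δ-off {s = s} {i} i≢s with i Fin.≟ s
  ... | yes i≡s = contradiction i≡s i≢s
  ... | no _ = ≈-refl

  sum-+δ : ∀ {N} (a x : Vector Carrier N) b s →
           sum (λ i → (a i + b * δ s i) * x i) ≈ sum (λ i → a i * x i) + b * x s
  sum-+δ a x b s = begin
    sum (λ i → (a i + b * δ s i) * x i)
      ≈⟨ sum-cong-≋ (λ i → distribʳ (x i) (a i) (b * δ s i)) ⟩
    sum (λ i → a i * x i + b * δ s i * x i)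
      ≈⟨ ∑-distrib-+ (λ i → a i * x i) (λ i → b * δ s i * x i) ⟩
    sum (λ i → a i * x i) + sum (λ i → b * δ s i * x i)
      ≈⟨ +-congˡ (sum-single s λ i i≢s →
           ≈-trans (*-congʳ (≈-trans (*-congˡ (δ-off i≢s)) (zeroʳ b))) (zeroˡ (x i))) ⟩
    sum (λ i → a i * x i) + b * δ s s * x s
      ≈⟨ +-congˡ (*-congʳ (≈-trans (*-congˡ (δ-diag s)) (*-identityʳ b))) ⟩
    sum (λ i → a i * x i) + b * x s ∎

  dot : ∀ {d} → Vector Carrier d → Vector Carrier d → Carrier
  dot f v = sum λ j → f j * v j

  dot-congʳ : ∀ {d} (f : Vector Carrier d) {v w} → (∀ j → v j ≈ w j) → dot f v ≈ dot f w
  dot-congʳ f v≈w = sum-cong-≋ λ j → *-congˡ (v≈w j)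

  dot-δ : ∀ {d} (f : Vector Carrier d) j → dot f (δ j) ≈ f j
  dot-δ f j = ≈-trans
    (sum-single j λ i i≢j → ≈-trans (*-congˡ (δ-off i≢j)) (zeroʳ (f i)))
    (≈-trans (*-congˡ (δ-diag j)) (*-identityʳ (f j)))

  dot-0 : ∀ {d} (f : Vector Carrier d) {v} → (∀ j → v j ≈ 0#) → dot f v ≈ 0#
  dot-0 f v≈0 = sum-zero λ j → ≈-trans (*-congˡ (v≈0 j)) (zeroʳ (f j))

  dot-+* : ∀ {d} (f v : Vector Carrier d) k u →
           dot f (λ j → v j + k * u j) ≈ dot f v + k * dot f u
  dot-+* f v k u = begin
    sum (λ j → f j * (v j + k * u j))
      ≈⟨ sum-cong-≋ (λ j → ≈-trans (distribˡ (f j) (v j) (k * u j))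
           (+-congˡ (x*[y*z]≈y*[x*z] (f j) k (u j)))) ⟩
    sum (λ j → f j * v j + k * (f j * u j))
      ≈⟨ ∑-distrib-+ (λ j → f j * v j) (λ j → k * (f j * u j)) ⟩
    dot f v + sum (λ j → k * (f j * u j))
      ≈⟨ +-congˡ (*-distribˡ-sum k (λ j → f j * u j)) ⟨
    dot f v + k * dot f u ∎

  dot-* : ∀ {d} (f : Vector Carrier d) k u → dot f (λ j → k * u j) ≈ k * dot f u
  dot-* f k u = ≈-trans (sum-cong-≋ λ j → x*[y*z]≈y*[x*z] (f j) k (u j))
                      (≈-sym (*-distribˡ-sum k (λ j → f j * u j)))

  comb : ∀ {d N} → (Fin N → Vector Carrier d) → Vector Carrier N → Vector Carrier d
  comb v a j = sum λ i → a i * v i j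

  dot-comb : ∀ {d N} (f : Vector Carrier d) (v : Fin N → Vector Carrier d) a →
             dot f (comb v a) ≈ sum (λ i → a i * dot f (v i))
  dot-comb f v a = begin
    sum (λ j → f j * sum (λ i → a i * v i j))
      ≈⟨ sum-cong-≋ (λ j → *-distribˡ-sum (f j) (λ i → a i * v i j)) ⟩
    sum (λ j → sum (λ i → f j * (a i * v i j)))
      ≈⟨ ∑-comm (λ j i → f j * (a i * v i j)) ⟩
    sum (λ i → sum (λ j → f j * (a i * v i j)))
      ≈⟨ sum-cong-≋ (λ i → dot-* f (a i) (v i)) ⟩
    sum (λ i → a i * dot f (v i)) ∎

  comb-+* : ∀ {d N} (v : Fin N → Vector Carrier d) a (k : Vector Carrier N) (u : Vector Carrier d) j →
            comb (λ i j → v i j + k i * u j) a j ≈ comb v a j + sum (λ i → a i * k i) * u j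
  comb-+* v a k u j = begin
    sum (λ i → a i * (v i j + k i * u j))
      ≈⟨ sum-cong-≋ (λ i → ≈-trans (distribˡ (a i) (v i j) (k i * u j))
           (+-congˡ (≈-sym (*-assoc (a i) (k i) (u j))))) ⟩
    sum (λ i → a i * v i j + a i * k i * u j)
      ≈⟨ ∑-distrib-+ (λ i → a i * v i j) (λ i → a i * k i * u j) ⟩
    comb v a j + sum (λ i → a i * k i * u j)
      ≈⟨ +-congˡ (*-distribʳ-sum (u j) (λ i → a i * k i)) ⟨
    comb v a j + sum (λ i → a i * k i) * u j ∎

  Nonzero : ∀ {d} → Vector Carrier d → Set ℓ
  Nonzero v = ¬ (∀ j → v j ≈ 0#)

  nonzero-coordinate : ∀ {d} {v : Vector Carrier d} → Nonzero v → ∃[ j ] ¬ v j ≈ 0#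
  nonzero-coordinate {v = v} v≉0 with any? (λ j → ¬? (v j ≈? 0#))
  ... | yes ∃j = ∃j
  ... | no ∄j = contradiction (λ j → decidable-stable (v j ≈? 0#) λ vj≉0 → ∄j (j , vj≉0)) v≉0

  -- Coefficients are indexed by all of `Fin N` and vanish off `S`, as in `LinearlyIndependent`, so
  -- passing between subsets needs no reindexing.
  Supported : ∀ {N} → Vector Carrier N → Subset N → Set ℓ
  Supported a S = ∀ {i} → i ∉ S → a i ≈ 0#

  Annihilates : ∀ {d N} → Vector Carrier d → (Fin N → Vector Carrier d) → Subset N → Set ℓ
  Annihilates f v S = ∀ {i} → i ∈ S → dot f (v i) ≈ 0#

  Spans : ∀ {d N} → (Fin N → Vector Carrier d) → Subset N → Set (c ⊔ ℓ)
  Spans {d} v S = ∀ (w : Vector Carrier d) → ∃[ a ] Supported a S × ∀ j → comb v a j ≈ w j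

  -- Gaussian elimination by induction on `d`. Without a pivot in coordinate `zero`, the functional
  -- `δ zero` annihilates the vectors of `S`. Otherwise `reduce` adds the multiple of `v p` that
  -- clears this coordinate, and the tails are treated in dimension `d`.
  annihilator⊎spans : ∀ {d N} (v : Fin N → Vector Carrier d) S →
                      (∃[ f ] Nonzero f × Annihilates f v S) ⊎ Spans v S
  annihilator⊎spans {zero} v S = inj₂ λ w → (λ _ → 0#) , (λ _ → ≈-refl) , λ ()
  annihilator⊎spans {suc d} {N} v S with any? (λ i → i ∈? S ×-dec ¬? (v i zero ≈? 0#))
  ... | no ∄i = inj₁ (δ zero , (λ δ≈0 → 1≉0 (≈-trans (≈-sym (δ-diag {suc d} zero)) (δ≈0 zero))) ,
    λ {i} i∈S → ≈-trans (dot-comm i) (decidable-stable (v i zero ≈? 0#) λ vi≉0 → ∄i (i , i∈S , vi≉0)))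
    where
    dot-comm : ∀ i → dot (δ zero) (v i) ≈ v i zero
    dot-comm i = ≈-trans (sum-cong-≋ λ j → *-comm (δ zero j) (v i j)) (dot-δ (v i) zero)
  ... | yes (p , p∈S , vp≉0) = result (annihilator⊎spans (λ i → tail (reduce (v i))) S)
    where
    p⁻¹ : Carrier
    p⁻¹ = proj₁ (inverse (v p zero) vp≉0)

    m : Vector Carrier (suc d) → Carrier
    m w = - (w zero * p⁻¹)

    reduce : Vector Carrier (suc d) → Vector Carrier (suc d)
    reduce w j = w j + m w * v p j

    reduce-zero : ∀ w → reduce w zero ≈ 0#
    reduce-zero w = begin
      w zero + - (w zero * p⁻¹) * v p zero
        ≈⟨ +-congˡ (-‿distribˡ-* (w zero * p⁻¹) (v p zero)) ⟨
      w zero + - (w zero * p⁻¹ * v p zero)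
        ≈⟨ +-congˡ (-‿cong (≈-trans (*-assoc (w zero) p⁻¹ (v p zero))
             (≈-trans (*-congˡ (≈-trans (*-comm p⁻¹ (v p zero)) (proj₂ (inverse (v p zero) vp≉0))))
               (*-identityʳ (w zero))))) ⟩
      w zero + - w zero
        ≈⟨ -‿inverseʳ (w zero) ⟩
      0# ∎

    result : (∃[ f ] Nonzero f × Annihilates f (λ i → tail (reduce (v i))) S) ⊎
             Spans (λ i → tail (reduce (v i))) S →
             (∃[ f ] Nonzero f × Annihilates f v S) ⊎ Spans v S
    result (inj₁ (f , f≉0 , ann)) =
      inj₁ (f⁺ , (λ f⁺≈0 → f≉0 (f⁺≈0 ∘ suc)) , λ {i} i∈S → ≈-trans (dot-f⁺ (v i)) (ann i∈S))
      where
      D : Carrier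
      D = dot f (tail (v p))
      -- The new coordinate is forced by the requirement that `f⁺` vanish on the pivot vector `v p`.
      f⁺ : Vector Carrier (suc d)
      f⁺ zero    = - (p⁻¹ * D)
      f⁺ (suc j) = f j
      dot-f⁺ : ∀ w → dot f⁺ w ≈ dot f (tail (reduce w))
      dot-f⁺ w = begin
        - (p⁻¹ * D) * w zero + dot f (tail w)
          ≈⟨ +-congʳ (-‿distribˡ-* (p⁻¹ * D) (w zero)) ⟨
        - (p⁻¹ * D * w zero) + dot f (tail w)
          ≈⟨ +-congʳ (-‿cong (≈-trans (*-comm (p⁻¹ * D) (w zero)) (≈-sym (*-assoc (w zero) p⁻¹ D)))) ⟩
        - (w zero * p⁻¹ * D) + dot f (tail w)
          ≈⟨ +-congʳ (-‿distribˡ-* (w zero * p⁻¹) D) ⟩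
        m w * D + dot f (tail w)
          ≈⟨ +-comm (m w * D) (dot f (tail w)) ⟩
        dot f (tail w) + m w * D
          ≈⟨ dot-+* f (tail w) (m w) (tail (v p)) ⟨
        dot f (tail (reduce w)) ∎
    result (inj₂ spans) = inj₂ λ w →
      let a , a-supp , comb≈ = spans (tail (reduce w))
          K = sum (λ i → a i * m (v i))
          comb-reduce : ∀ j → comb (reduce ∘ v) a j ≈ reduce w j
          comb-reduce = λ where
            zero → ≈-trans
              (sum-zero λ i → ≈-trans (*-congˡ (reduce-zero (v i))) (zeroʳ (a i)))
              (≈-sym (reduce-zero w))
            (suc j) → comb≈ j
      -- Undoing the reductions in `comb (reduce ∘ v) a = reduce w` gives
      -- `w = comb v a + (K - m w) v p`, so only the coefficient of the pivot is corrected.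
      in (λ i → a i + (K + - m w) * δ p i) ,
         (λ {i} i∉S → ≈-trans
           (+-cong (a-supp i∉S)
             (≈-trans (*-congˡ (δ-off λ i≡p → i∉S (subst (_∈ S) (sym i≡p) p∈S))) (zeroʳ _)))
           (+-identityˡ 0#)) ,
         λ j → begin
           comb v (λ i → a i + (K + - m w) * δ p i) j
             ≈⟨ sum-+δ a (λ i → v i j) (K + - m w) p ⟩
           comb v a j + (K + - m w) * v p j
             ≈⟨ +-congˡ (distribʳ (v p j) K (- m w)) ⟩
           comb v a j + (K * v p j + - m w * v p j)
             ≈⟨ +-assoc (comb v a j) (K * v p j) (- m w * v p j) ⟨
           comb v a j + K * v p j + - m w * v p j
             ≈⟨ +-congʳ (comb-+* v a (m ∘ v) (v p) j) ⟨
           comb (reduce ∘ v) a j + - m w * v p j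
             ≈⟨ +-congʳ (comb-reduce j) ⟩
           w j + m w * v p j + - m w * v p j
             ≈⟨ +-assoc (w j) (m w * v p j) (- m w * v p j) ⟩
           w j + (m w * v p j + - m w * v p j)
             ≈⟨ +-congˡ (≈-trans (+-congˡ (≈-sym (-‿distribˡ-* (m w) (v p j)))) (-‿inverseʳ (m w * v p j))) ⟩
           w j + 0#
             ≈⟨ +-identityʳ (w j) ⟩
           w j ∎

  -- Applying `f` to a linear relation kills every term except that of `s`. So the coefficient of
  -- `s` is zero and the relation already lives on `B`.
  independent-∪⁅⁆ : ∀ {d N} {v : Fin N → Vector Carrier d} {B s f} →
    LinearlyIndependent F v B → Annihilates f v B → ¬ dot f (v s) ≈ 0# →
    LinearlyIndependent F v (B ∪ ⁅ s ⁆)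
  independent-∪⁅⁆ {v = v} {B} {s} {f} indep ann fs≉0 a a-supp comb≈0 =
    indep a a-supp-B comb≈0
    where
    ∉-∪⁅⁆ : ∀ {i} → i ∉ B → i ≢ s → i ∉ B ∪ ⁅ s ⁆
    ∉-∪⁅⁆ i∉B i≢s i∈ with x∈p∪q⁻ B ⁅ s ⁆ i∈
    ... | inj₁ i∈B = i∉B i∈B
    ... | inj₂ i∈⁅s⁆ = i≢s (x∈⁅y⁆⇒x≡y s i∈⁅s⁆)

    other-terms : ∀ i → i ≢ s → a i * dot f (v i) ≈ 0#
    other-terms i i≢s with i ∈? B
    ... | yes i∈B = ≈-trans (*-congˡ (ann i∈B)) (zeroʳ (a i))
    ... | no i∉B = ≈-trans (*-congʳ (a-supp (∉-∪⁅⁆ i∉B i≢s))) (zeroˡ _)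

    as≈0 : a s ≈ 0#
    as≈0 = *-cancelʳ-0 fs≉0 (begin
      a s * dot f (v s)              ≈⟨ sum-single s other-terms ⟨
      sum (λ i → a i * dot f (v i))  ≈⟨ dot-comb f v a ⟨
      dot f (comb v a)               ≈⟨ dot-0 f comb≈0 ⟩
      0#                             ∎)

    a-supp-B : Supported a B
    a-supp-B {i} i∉B with i Fin.≟ s
    ... | yes refl = as≈0
    ... | no i≢s = a-supp (∉-∪⁅⁆ i∉B i≢s)

  -- For `s` in `T` but outside `B`, writing `v s` as a combination over `B` gives a relation on `T`
  -- in which `s` has coefficient `- 1#`.
  spans⇒maximal : ∀ {d N} {v : Fin N → Vector Carrier d} {B T} → Spans v B → B ⊆ T →
                  LinearlyIndependent F v T → T ⊆ B
  spans⇒maximal {v = v} {B} {T} spans B⊆T indep {s} s∈T =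
    decidable-stable (s ∈? B) λ s∉B →
      let b , b-supp , comb≈ = spans (v s)
          a = λ i → b i + - 1# * δ s i
          as≈0 = indep a
            (λ {i} i∉T → ≈-trans
              (+-cong (b-supp (i∉T ∘ B⊆T))
                (≈-trans (*-congˡ (δ-off λ i≡s → i∉T (subst (_∈ T) (sym i≡s) s∈T))) (zeroʳ (- 1#))))
              (+-identityˡ 0#))
            (λ j → begin
              comb v a j               ≈⟨ sum-+δ b (λ i → v i j) (- 1#) s ⟩
              comb v b j + - 1# * v s j ≈⟨ +-cong (comb≈ j)
                (≈-trans (≈-sym (-‿distribˡ-* 1# (v s j))) (-‿cong (*-identityˡ (v s j)))) ⟩
              v s j + - v s j          ≈⟨ -‿inverseʳ (v s j) ⟩
              0#                       ∎)
            s
      in 1≉0 (-x≈0⇒x≈0 (begin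
        - 1#                 ≈⟨ *-identityʳ (- 1#) ⟨
        - 1# * 1#            ≈⟨ *-congˡ (δ-diag s) ⟨
        - 1# * δ s s         ≈⟨ +-identityˡ _ ⟨
        0# + - 1# * δ s s    ≈⟨ +-congʳ (b-supp s∉B) ⟨
        b s + - 1# * δ s s   ≈⟨ as≈0 ⟩
        0#                   ∎))

  ≉0-* : ∀ {x y} → ¬ x ≈ 0# → ¬ y ≈ 0# → ¬ x * y ≈ 0#
  ≉0-* x≉0 y≉0 = x≉0 ∘ *-cancelʳ-0 y≉0

  -- A vector space is not the union of two hyperplanes. If neither `δ i` nor `δ j` serves both
  -- functionals, their sum does, because each functional sees exactly one of the two summands.
  common-nonzero : ∀ {d} {f g : Vector Carrier d} → Nonzero f → Nonzero g →
                   ∃[ u ] (¬ dot f u ≈ 0#) × (¬ dot g u ≈ 0#)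
  common-nonzero {f = f} {g} f≉0 g≉0
    with i , fi≉0 ← nonzero-coordinate f≉0 | j , gj≉0 ← nonzero-coordinate g≉0
    with f j ≈? 0# | g i ≈? 0#
  ... | no fj≉0 | _ = δ j , fj≉0 ∘ ≈-trans (≈-sym (dot-δ f j)) , gj≉0 ∘ ≈-trans (≈-sym (dot-δ g j))
  ... | yes _ | no gi≉0 = δ i , fi≉0 ∘ ≈-trans (≈-sym (dot-δ f i)) , gi≉0 ∘ ≈-trans (≈-sym (dot-δ g i))
  ... | yes fj≈0 | yes gi≈0 = u ,
    (fi≉0 ∘ ≈-trans (≈-sym (≈-trans (dot-u f) (≈-trans (+-congˡ fj≈0) (+-identityʳ (f i)))))) ,
    (gj≉0 ∘ ≈-trans (≈-sym (≈-trans (dot-u g) (≈-trans (+-congʳ gi≈0) (+-identityˡ (g j))))))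
    where
    u : Vector Carrier _
    u k = δ i k + 1# * δ j k
    dot-u : ∀ h → dot h u ≈ h i + h j
    dot-u h = ≈-trans (dot-+* h (δ i) 1# (δ j))
      (+-cong (dot-δ h i) (≈-trans (*-identityˡ (dot h (δ j))) (dot-δ h j)))

  -- The coefficient of u is chosen so that f ∘ shift = g.

  module _ {d} (f g u : Vector Carrier d) (fu≉0 : ¬ dot f u ≈ 0#) where

    coefficient : Vector Carrier d → Carrier
    coefficient v = proj₁ (inverse (dot f u) fu≉0) * (dot g v + - dot f v)

    shift : Vector Carrier d → Vector Carrier d
    shift v j = v j + coefficient v * u j

    coefficient-dot : ∀ v → coefficient v * dot f u ≈ dot g v + - dot f v
    coefficient-dot v = let s , fu*s≈1 = inverse (dot f u) fu≉0 in begin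
      s * (dot g v + - dot f v) * dot f u   ≈⟨ *-assoc s _ (dot f u) ⟩
      s * ((dot g v + - dot f v) * dot f u) ≈⟨ x*[y*z]≈y*[x*z] s _ (dot f u) ⟩
      (dot g v + - dot f v) * (s * dot f u) ≈⟨ *-congˡ (≈-trans (*-comm s (dot f u)) fu*s≈1) ⟩
      (dot g v + - dot f v) * 1#            ≈⟨ *-identityʳ _ ⟩
      dot g v + - dot f v                   ∎

    dot-shift : ∀ v → dot f (shift v) ≈ dot g v
    dot-shift v = begin
      dot f (shift v)                   ≈⟨ dot-+* f v (coefficient v) u ⟩
      dot f v + coefficient v * dot f u ≈⟨ +-congˡ (coefficient-dot v) ⟩
      dot f v + (dot g v + - dot f v)   ≈⟨ x+[y-x]≈y (dot f v) (dot g v) ⟩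
      dot g v                           ∎

    coefficient-cong : ∀ {v w} → (∀ j → v j ≈ w j) → coefficient v ≈ coefficient w
    coefficient-cong v≈w = *-congˡ (+-cong (dot-congʳ g v≈w) (-‿cong (dot-congʳ f v≈w)))

    shift-cong : ∀ {v w} → (∀ j → v j ≈ w j) → ∀ j → shift v j ≈ shift w j
    shift-cong v≈w j = +-cong (v≈w j) (*-congʳ (coefficient-cong v≈w))

    -- This is the functional `(g - f) / f(u)`. Writing `coefficient` as a dot product with it
    -- reduces the linearity of `shift` to the lemmas on `dot`.
    κ : Vector Carrier d
    κ j = proj₁ (inverse (dot f u) fu≉0) * (g j + - 1# * f j)

    coefficient-linear : ∀ v → coefficient v ≈ dot κ v
    coefficient-linear v = let s = proj₁ (inverse (dot f u) fu≉0) in begin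
      s * (dot g v + - dot f v)
        ≈⟨ *-congˡ (+-cong (dot-comm g) (≈-trans (-‿cong (dot-comm f)) -≈)) ⟩
      s * (dot v g + - 1# * dot v f)
        ≈⟨ *-congˡ (dot-+* v g (- 1#) f) ⟨
      s * dot v (λ j → g j + - 1# * f j)
        ≈⟨ dot-* v s (λ j → g j + - 1# * f j) ⟨
      dot v κ
        ≈⟨ dot-comm′ ⟩
      dot κ v ∎
      where
      dot-comm : ∀ w → dot w v ≈ dot v w
      dot-comm w = sum-cong-≋ λ j → *-comm (w j) (v j)
      dot-comm′ : dot v κ ≈ dot κ v
      dot-comm′ = sum-cong-≋ λ j → *-comm (v j) (κ j)
      -≈ : - dot v f ≈ - 1# * dot v f
      -≈ = ≈-trans (-‿cong (≈-sym (*-identityˡ (dot v f)))) (-‿distribˡ-* 1# (dot v f))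

    shift-comb : ∀ {N} (v : Fin N → Vector Carrier d) a j →
                 shift (comb v a) j ≈ comb (shift ∘ v) a j
    shift-comb v a j = begin
      comb v a j + coefficient (comb v a) * u j
        ≈⟨ +-congˡ (*-congʳ (coefficient-linear (comb v a))) ⟩
      comb v a j + dot κ (comb v a) * u j
        ≈⟨ +-congˡ (*-congʳ (dot-comb κ v a)) ⟩
      comb v a j + sum (λ i → a i * dot κ (v i)) * u j
        ≈⟨ +-congˡ (*-congʳ (sum-cong-≋ λ i → *-congˡ (coefficient-linear (v i)))) ⟨
      comb v a j + sum (λ i → a i * coefficient (v i)) * u j
        ≈⟨ comb-+* v a (coefficient ∘ v) u j ⟨
      comb (shift ∘ v) a j ∎

    shift-* : ∀ b v j → shift (λ j → b * v j) j ≈ b * shift v j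
    shift-* b v j = begin
      b * v j + coefficient (λ j → b * v j) * u j
        ≈⟨ +-congˡ (*-congʳ (≈-trans (coefficient-linear (λ j → b * v j))
             (≈-trans (dot-* κ b v) (*-congˡ (≈-sym (coefficient-linear v)))))) ⟩
      b * v j + b * coefficient v * u j
        ≈⟨ +-congˡ (*-assoc b (coefficient v) (u j)) ⟩
      b * v j + b * (coefficient v * u j)
        ≈⟨ distribˡ b (v j) (coefficient v * u j) ⟨
      b * shift v j ∎

    shift-0 : ∀ {v} → (∀ j → v j ≈ 0#) → ∀ j → shift v j ≈ 0#
    shift-0 {v} v≈0 j = ≈-trans (+-cong (v≈0 j) (≈-trans (*-congʳ
      (≈-trans (coefficient-linear v) (dot-0 κ v≈0))) (zeroˡ (u j)))) (+-identityˡ 0#)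

  module _ {d} (f g u : Vector Carrier d) (fu≉0 : ¬ dot f u ≈ 0#) (gu≉0 : ¬ dot g u ≈ 0#) where

    -- Both shifts move along the same `u`, so they are mutually inverse once their coefficients
    -- cancel. This is checked after multiplication by `dot g u`, using that `f` takes at the
    -- shifted vector the value of `g` at `v`.
    coefficient-shift : ∀ v → coefficient f g u fu≉0 v +
                              coefficient g f u gu≉0 (shift f g u fu≉0 v) ≈ 0#
    coefficient-shift v = *-cancelʳ-0 gu≉0 (begin
      (k + k′) * dot g u
        ≈⟨ distribʳ (dot g u) k k′ ⟩
      k * dot g u + k′ * dot g u
        ≈⟨ +-congˡ (coefficient-dot g f u gu≉0 w) ⟩
      k * dot g u + (dot f w + - dot g w)
        ≈⟨ +-congˡ (+-congʳ (dot-shift f g u fu≉0 v)) ⟩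
      k * dot g u + (dot g v + - dot g w)
        ≈⟨ +-assoc (k * dot g u) (dot g v) (- dot g w) ⟨
      k * dot g u + dot g v + - dot g w
        ≈⟨ +-congʳ (≈-trans (+-comm (k * dot g u) (dot g v)) (≈-sym (dot-+* g v k u))) ⟩
      dot g w + - dot g w
        ≈⟨ -‿inverseʳ (dot g w) ⟩
      0# ∎)
      where
      w = shift f g u fu≉0 v
      k = coefficient f g u fu≉0 v
      k′ = coefficient g f u gu≉0 w

    shift-shift : ∀ v j → shift g f u gu≉0 (shift f g u fu≉0 v) j ≈ v j
    shift-shift v j = begin
      v j + k * u j + k′ * u j   ≈⟨ +-assoc (v j) (k * u j) (k′ * u j) ⟩
      v j + (k * u j + k′ * u j) ≈⟨ +-congˡ (distribʳ (u j) k k′) ⟨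
      v j + (k + k′) * u j       ≈⟨ +-congˡ (≈-trans (*-congʳ (coefficient-shift v)) (zeroˡ (u j))) ⟩
      v j + 0#                   ≈⟨ +-identityʳ (v j) ⟩
      v j                        ∎
      where
      k = coefficient f g u fu≉0 v
      k′ = coefficient g f u gu≉0 (shift f g u fu≉0 v)

    shift-nonzero : ∀ {v} → Nonzero v → Nonzero (shift f g u fu≉0 v)
    shift-nonzero v≉0 Tv≈0 = v≉0 λ j →
      ≈-trans (≈-sym (shift-shift _ j)) (shift-0 g f u gu≉0 Tv≈0 j)

-- Projective geometries and the circuits of their duals

module PG {q c ℓ} (F : FiniteField q c ℓ) (n : ℕ) {N} {M : Matroid N}
          (pg : IsProjectiveGeometry F n M) where
  open FiniteField F hiding (zero; _-_)
    renaming (refl to ≈-refl; sym to ≈-sym; trans to ≈-trans)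
  open SemiringSum semiring
  open LinearAlgebra F
  open IsProjectiveGeometry pg
  open import Relation.Binary.Reasoning.Setoid setoid

  generator-nonzero : ∀ i → Nonzero (generator i)
  generator-nonzero i = proj₂ (Bijection.to points i)

  scalar-nonzero : ∀ {d} {v w : Vector Carrier d} {a} → Nonzero w → (∀ j → w j ≈ a * v j) → ¬ a ≈ 0#
  scalar-nonzero {v = v} w≉0 w≈av a≈0 =
    w≉0 λ j → ≈-trans (w≈av j) (≈-trans (*-congʳ a≈0) (zeroˡ (v j)))

  span-≐ : ∀ {d} {v w : Vector Carrier d} {a} → Nonzero w → (∀ j → w j ≈ a * v j) →
           span F v ≐ span F w
  span-≐ {v = v} {w} {a} w≉0 w≈av =
    let a⁻¹ , aa⁻¹≈1 = inverse a (scalar-nonzero w≉0 w≈av)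
    in (λ {x} (b , x≈bv) → b * a⁻¹ , λ j → begin
         x j                  ≈⟨ x≈bv j ⟩
         b * v j              ≈⟨ *-congˡ (*-identityˡ (v j)) ⟨
         b * (1# * v j)       ≈⟨ *-congˡ (*-congʳ (≈-trans (*-comm a⁻¹ a) aa⁻¹≈1)) ⟨
         b * (a⁻¹ * a * v j)  ≈⟨ *-congˡ (*-assoc a⁻¹ a (v j)) ⟩
         b * (a⁻¹ * (a * v j)) ≈⟨ *-congˡ (*-congˡ (w≈av j)) ⟨
         b * (a⁻¹ * w j)      ≈⟨ *-assoc b a⁻¹ (w j) ⟨
         b * a⁻¹ * w j        ∎) ,
       (λ {x} (b , x≈bw) → b * a , λ j → begin
         x j           ≈⟨ x≈bw j ⟩
         b * w j       ≈⟨ *-congˡ (w≈av j) ⟩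
         b * (a * v j) ≈⟨ *-assoc b a (v j) ⟨
         b * a * v j   ∎)

  point : ∀ v → Nonzero v → ∃[ i ] ∃[ a ] ∀ j → generator i j ≈ a * v j
  point v v≉0 =
    let i , to-i≈ = Bijection.surjective points (v , v≉0)
    in i , proj₁ (to-i≈ refl) (1# , λ j → ≈-sym (*-identityˡ (generator i j)))

  proportional⇒≡ : ∀ {i k a} → (∀ j → generator k j ≈ a * generator i j) → i ≡ k
  proportional⇒≡ {k = k} eq = Bijection.injective points (span-≐ (generator-nonzero k) eq)

  -- `T` carries lines through the origin to such lines, but the chosen generators correspond only
  -- up to a factor. `scale` records that factor.
  module Collineation (f g u : Vector Carrier (suc n))
                      (fu≉0 : ¬ dot f u ≈ 0#) (gu≉0 : ¬ dot g u ≈ 0#) where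

    T : Vector Carrier (suc n) → Vector Carrier (suc n)
    T = shift f g u fu≉0

    image-point : ∀ i → ∃[ k ] ∃[ a ] ∀ j → generator k j ≈ a * T (generator i) j
    image-point i = point (T (generator i)) (shift-nonzero f g u fu≉0 gu≉0 (generator-nonzero i))

    move : Fin N → Fin N
    move = proj₁ ∘ image-point

    scale : Fin N → Carrier
    scale = proj₁ ∘ proj₂ ∘ image-point

    generator-move : ∀ i j → generator (move i) j ≈ scale i * T (generator i) j
    generator-move = proj₂ ∘ proj₂ ∘ image-point

    scale≉0 : ∀ i → ¬ scale i ≈ 0#
    scale≉0 i = scalar-nonzero (generator-nonzero (move i)) (generator-move i)

    dot-move : ∀ i → dot f (generator (move i)) ≈ scale i * dot g (generator i)
    dot-move i = ≈-trans (dot-congʳ f (generator-move i))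
      (≈-trans (dot-* f (scale i) (T (generator i))) (*-congˡ (dot-shift f g u fu≉0 (generator i))))

  module _ (f g u : Vector Carrier (suc n))
           (fu≉0 : ¬ dot f u ≈ 0#) (gu≉0 : ¬ dot g u ≈ 0#) where
    private
      module Fw = Collineation f g u fu≉0 gu≉0
      module Bw = Collineation g f u gu≉0 fu≉0

    move-move : ∀ i → Bw.move (Fw.move i) ≡ i
    move-move i = sym (proportional⇒≡ λ j → begin
      generator (Bw.move (Fw.move i)) j
        ≈⟨ Bw.generator-move (Fw.move i) j ⟩
      b * Bw.T (generator (Fw.move i)) j
        ≈⟨ *-congˡ (shift-cong g f u gu≉0 (Fw.generator-move i) j) ⟩
      b * Bw.T (λ j → a * Fw.T (generator i) j) j
        ≈⟨ *-congˡ (shift-* g f u gu≉0 a (Fw.T (generator i)) j) ⟩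
      b * (a * Bw.T (Fw.T (generator i)) j)
        ≈⟨ *-congˡ (*-congˡ (shift-shift f g u fu≉0 gu≉0 (generator i) j)) ⟩
      b * (a * generator i j)
        ≈⟨ *-assoc b a (generator i j) ⟨
      b * a * generator i j ∎)
      where
      a = Fw.scale i
      b = Bw.scale (Fw.move i)

  module _ (f g u : Vector Carrier (suc n))
           (fu≉0 : ¬ dot f u ≈ 0#) (gu≉0 : ¬ dot g u ≈ 0#) where
    private
      module Fw = Collineation f g u fu≉0 gu≉0
      module Bw = Collineation g f u gu≉0 fu≉0

    collineation : Permutation′ N
    collineation = permutation Fw.move Bw.move
      (move-move g f u gu≉0 fu≉0) (move-move f g u fu≉0 gu≉0)

    -- A relation `a` on the image is pulled back to `b`, which absorbs the scale factors. `T` sends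
    -- the combination given by `b` to the one given by `a`, which is zero, and `T` is invertible.
    linearlyIndependent-image : ∀ {S} → LinearlyIndependent F generator S →
                                LinearlyIndependent F generator (image collineation S)
    linearlyIndependent-image {S} indep a a-supp comb≈0 k =
      subst (λ k → a k ≈ 0#) (inverseʳ collineation)
        (*-cancelʳ-0 (Fw.scale≉0 i) (indep b b-supp comb-b≈0 i))
      where
      i = Bw.move k

      b : Vector Carrier N
      b i = a (Fw.move i) * Fw.scale i

      b-supp : Supported b S
      b-supp {i} i∉S = ≈-trans
        (*-congʳ (a-supp (i∉S ∘ ∈-image-ʳ⁻ collineation S))) (zeroˡ (Fw.scale i))

      comb-T≈0 : ∀ j → comb (Fw.T ∘ generator) b j ≈ 0#
      comb-T≈0 j = begin
        sum (λ i → a (Fw.move i) * Fw.scale i * Fw.T (generator i) j)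
          ≈⟨ sum-cong-≋ (λ i → ≈-trans (*-assoc (a (Fw.move i)) (Fw.scale i) (Fw.T (generator i) j))
               (*-congˡ (≈-sym (Fw.generator-move i j)))) ⟩
        sum (λ i → a (Fw.move i) * generator (Fw.move i) j)
          ≈⟨ sum-permute (λ k → a k * generator k j) collineation ⟨
        comb generator a j
          ≈⟨ comb≈0 j ⟩
        0# ∎

      comb-b≈0 : ∀ j → comb generator b j ≈ 0#
      comb-b≈0 j = begin
        comb generator b j
          ≈⟨ shift-shift f g u fu≉0 gu≉0 (comb generator b) j ⟨
        Bw.T (Fw.T (comb generator b)) j
          ≈⟨ shift-0 g f u gu≉0 (λ j → ≈-trans (shift-comb f g u fu≉0 generator b j) (comb-T≈0 j)) j ⟩
        0# ∎

    independent-image : ∀ {S} → Independent M S → Independent M (image collineation S)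
    independent-image {S} ind = Equivalence.from (independent (image collineation S))
      (linearlyIndependent-image {S} (Equivalence.to (independent S) ind))

  collineation-preserves : ∀ f g u fu≉0 gu≉0 → PreservesIndependence M (collineation f g u fu≉0 gu≉0)
  collineation-preserves f g u fu≉0 gu≉0 = record
    { image⁺ = λ {S} → independent-image f g u fu≉0 gu≉0 {S}
    ; image⁻ = λ {S} ind → subst (Independent M) (image-flip φ S)
        (independent-image g f u gu≉0 fu≉0 {image φ S} ind)
    }
    where φ = collineation f g u fu≉0 gu≉0

  independent-extend : ∀ {f B i} → Independent M B → Annihilates f generator B →
                       ¬ dot f (generator i) ≈ 0# → Independent M (B ∪ ⁅ i ⁆)
  independent-extend {f} {B} {i} ind ann fi≉0 = Equivalence.from (independent (B ∪ ⁅ i ⁆))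
    (independent-∪⁅⁆ {f = f} (Equivalence.to (independent B) ind) ann fi≉0)

  -- Some standard basis vector lies off the hyperplane of `f`. Adding its point to `B` would keep
  -- independence, so by maximality the point is already in `B`, where `f` vanishes.
  basis-not-annihilated : ∀ {f B} → Nonzero f → Basis M B → ¬ Annihilates f generator B
  basis-not-annihilated {f} {B} f≉0 (ind , max) ann =
    let j , fj≉0 = nonzero-coordinate f≉0
        i , a , gen≈ = point (δ j) λ δ≈0 → 1≉0 (≈-trans (≈-sym (δ-diag j)) (δ≈0 j))
        a≉0 = scalar-nonzero (generator-nonzero i) gen≈
        dot≈ = ≈-trans (dot-congʳ f gen≈) (≈-trans (dot-* f a (δ j)) (*-congˡ (dot-δ f j)))
        fi≉0 = ≉0-* a≉0 fj≉0 ∘ ≈-trans (≈-sym dot≈)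
    in fi≉0 (ann (max (independent-extend {f} ind ann fi≉0) (p⊆p∪q ⁅ i ⁆) (x∈p∪q⁺ (inj₂ (x∈⁅x⁆ i)))))

  module _ (M* : Matroid N) (dual : IsDual M M*) where
    open Matroid M* using (Circuit)

    record IsHyperplaneComplement (f : Vector Carrier (suc n)) (C : Subset N) : Set ℓ where
      field
        nonzero : Nonzero f
        ∈⇒≉0   : ∀ {i} → i ∈ C → ¬ dot f (generator i) ≈ 0#
        ≉0⇒∈   : ∀ {i} → ¬ dot f (generator i) ≈ 0# → i ∈ C

    -- If `B` spanned the space, it would be a basis of `M`, and the circuit `C` would lie in the
    -- basis `∁ B` of `M*`. So some `f` annihilates `B`, and a point of `∁ C` off its hyperplane
    -- could be added to `B`.
    maximal⇒annihilator : ∀ {B C} → Circuit C → MaximalIn M (∁ C) B →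
                          ∃[ f ] Nonzero f × Annihilates f generator (∁ C)
    maximal⇒annihilator {B} {C} c max with annihilator⊎spans generator B
    ... | inj₁ (f , f≉0 , ann) = f , f≉0 , λ {i} i∈∁C →
      decidable-stable (dot f (generator i) ≈? 0#) λ fi≉0 →
        fi≉0 (ann (maximal i∈∁C (independent-extend {f} indep ann fi≉0)))
      where open MaximalIn max
    ... | inj₂ spans = contradiction
      (λ {x} x∈C → x∉p⇒x∈∁p λ x∈B → x∈∁p⇒x∉p (⊆X {x} x∈B) x∈C)
      (proj₁ ∁B-basis c)
      where
      open MaximalIn max
      ∁B-basis : Basis M* (∁ B)
      ∁B-basis = Equivalence.from (dual (∁ B)) (subst (Basis M) (sym (∁-involutive B))
        (indep , λ {S} indS B⊆S →
          spans⇒maximal spans B⊆S (Equivalence.to (independent S) indS)))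

    circuit⇒annihilator : ∀ {C} → Circuit C → ∃[ f ] Nonzero f × Annihilates f generator (∁ C)
    circuit⇒annihilator {C} c =
      let B , _ , max = independent⇒⊆maximal M {⊥} {∁ C} ⊥⊆ independent-⊥
      in maximal⇒annihilator c max
      where
      independent-⊥ : Independent M ⊥
      independent-⊥ d D⊆⊥ = Matroid.nonempty M (subst (Matroid.Circuit M)
        (Empty-unique λ (x , x∈D) → ∉⊥ (D⊆⊥ x∈D)) d)

    circuit-minus : ∀ {C i} → Circuit C → i ∈ C → Independent M* (C - i)
    circuit-minus {C} {i} c i∈C with independent⊎⊇circuit M* (C - i)
    ... | inj₁ ind = ind
    ... | inj₂ (D , d , D⊆) = contradiction
      (x∈p⇒∣p-x∣<∣p∣ i∈C)
      (ℕ.≤⇒≯ (p⊆q⇒∣p∣≤∣q∣ (subst (_⊆ C - i)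
        (Matroid.minimal M* d c (p─q⊆p C ⁅ i ⁆ ∘ D⊆)) D⊆)))

    -- If `f` vanished at some `i` in `C`, a basis of `M*` containing `C - i` would have its
    -- complement inside `∁ C` together with `i`. That complement is a basis of `M` annihilated by
    -- `f`.
    circuit⇒hyperplaneComplement : ∀ {C} → Circuit C → ∃[ f ] IsHyperplaneComplement f C
    circuit⇒hyperplaneComplement {C} c =
      let f , f≉0 , ann = circuit⇒annihilator c
      in f , record
        { nonzero = f≉0
        ; ≉0⇒∈ = λ {i} fi≉0 → decidable-stable (i ∈? C) λ i∉C → fi≉0 (ann (x∉p⇒x∈∁p i∉C))
        ; ∈⇒≉0 = λ {i} i∈C fi≈0 →
            let B , C-i⊆B , basis = independent⇒⊆basis M* (circuit-minus c i∈C)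
            in basis-not-annihilated {f} {∁ B} f≉0 (Equivalence.to (dual B) basis) λ {x} x∈∁B →
                 decidable-stable (dot f (generator x) ≈? 0#) λ fx≉0 →
                   fx≉0 (ann (x∉p⇒x∈∁p λ x∈C → x∈∁p⇒x∉p x∈∁B (C-i⊆B
                     (x∈p∧x≢y⇒x∈p-y x∈C λ x≡i →
                       fx≉0 (subst (λ x → dot f (generator x) ≈ 0#) (sym x≡i) fi≈0)))))
        }

    dual-equitable : Equitable M*
    dual-equitable {C₁} {C₂} c₁ c₂ =
      -- The functional of `C₁` is called `g` because the shift satisfies `f ∘ T = g` and so carries
      -- the hyperplane of `g` to that of `f`.
      let g , hyp₁ = circuit⇒hyperplaneComplement c₁
          f , hyp₂ = circuit⇒hyperplaneComplement c₂
          module H₁ = IsHyperplaneComplement hyp₁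
          module H₂ = IsHyperplaneComplement hyp₂
          u , fu≉0 , gu≉0 = common-nonzero H₂.nonzero H₁.nonzero
          open Collineation f g u fu≉0 gu≉0
          φ = collineation f g u fu≉0 gu≉0
          ≉0-move : ∀ {i} → i ∈ C₁ → move i ∈ C₂
          ≉0-move {i} i∈C₁ = H₂.≉0⇒∈ (≉0-* (scale≉0 i) (H₁.∈⇒≉0 i∈C₁) ∘ ≈-trans (≈-sym (dot-move i)))
          move-≉0 : ∀ {i} → move i ∈ C₂ → i ∈ C₁
          move-≉0 {i} mi∈C₂ = H₁.≉0⇒∈ λ gi≈0 → H₂.∈⇒≉0 mi∈C₂
            (≈-trans (dot-move i) (≈-trans (*-congˡ gi≈0) (zeroʳ (scale i))))
          φC₁≡C₂ : image φ C₁ ≡ C₂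
          φC₁≡C₂ = ⊆-antisym
            (λ i∈ → subst (_∈ C₂) (inverseʳ φ) (≉0-move (∈-image⁻ φ C₁ i∈)))
            (λ i∈ → ∈-image⁺ φ C₁ (move-≉0 (subst (_∈ C₂) (sym (inverseʳ φ)) i∈)))
      in trans (preserves⇒β {M = M*} (dual-preserves dual (collineation-preserves f g u fu≉0 gu≉0)) C₁)
               (cong (β M*) φC₁≡C₂)

-- Linear spaces

injective⇒∃-preimage : ∀ {f : Fin n → Fin n} → Injective _≡_ _≡_ f → ∀ j → ∃[ i ] f i ≡ j
injective⇒∃-preimage {suc n} {f} f-injective j with any? (λ i → f i Fin.≟ j)
... | yes ∃i = ∃i
... | no ∄i = contradiction
  (injective⇒≤ {f = λ i → punchOut (j≢f i)} λ {i} {k} eq →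
    f-injective (punchOut-injective (j≢f i) (j≢f k) eq))
  ℕ.1+n≰n
  where
  j≢f : ∀ i → j ≢ f i
  j≢f i eq = ∄i (i , sym eq)

∈₂⇒2≤∣∣ : ∀ {S : Subset n} {a b} → a ≢ b → a ∈ S → b ∈ S → 2 ℕ.≤ ∣ S ∣
∈₂⇒2≤∣∣ {S = S} {a} {b} a≢b a∈S b∈S = ℕ.≤-trans
  (s≤s (ℕ.≤-trans (ℕ.≤-reflexive (sym (∣⁅x⁆∣≡1 b)))
    (p⊆q⇒∣p∣≤∣q∣ λ x∈ → subst (_∈ S - a) (sym (x∈⁅y⁆⇒x≡y b x∈))
      (x∈p∧x≢y⇒x∈p-y b∈S (a≢b ∘ sym)))))
  (x∈p⇒∣p-x∣<∣p∣ a∈S)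

module _ (φ : Permutation′ n) {C : Subset n} {k} {σ : Vec (Fin n) k} where

  lookup-map-∉⁺ : ∀ i → lookup σ i ∉ C → lookup (Vec.map (φ ⟨$⟩ʳ_) σ) i ∉ image φ C
  lookup-map-∉⁺ i ∉C = ∉C ∘ ∈-image-ʳ⁻ φ C ∘ subst (_∈ image φ C) (lookup-map i _ σ)

  lookup-map-∉⁻ : ∀ i → lookup (Vec.map (φ ⟨$⟩ʳ_) σ) i ∉ image φ C → lookup σ i ∉ C
  lookup-map-∉⁻ i ∉φC = ∉φC ∘ subst (_∈ image φ C) (sym (lookup-map i _ σ)) ∘ ∈-image-ʳ⁺ φ C

-- `proper` keeps the complement of a line from being empty. `two-points` makes every line subject
-- to `unique`.
record LinearSpace (n : ℕ) : Set₁ where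
  field
    Line       : Pred (Subset n) 0ℓ
    line?      : Decidable Line
    proper     : ¬ Line ⊤
    two-points : ∀ {L} → Line L → ∃[ a ] ∃[ b ] a ≢ b × a ∈ L × b ∈ L
    through    : ∀ a b → a ≢ b → ∃[ L ] Line L × a ∈ L × b ∈ L
    unique     : ∀ {a b L L′} → a ≢ b → Line L → a ∈ L → b ∈ L →
                 Line L′ → a ∈ L′ → b ∈ L′ → L ≡ L′

-- The hyperplanes of a simple matroid of rank 3 are the lines of a linear
-- space; the circuits of the dual matroid are their complements.

module _ (𝓛 : LinearSpace n) where
  open LinearSpace 𝓛

  cocircuit-minimal : ∀ {C₁ C₂} → Line (∁ C₁) → Line (∁ C₂) → C₁ ⊆ C₂ → C₁ ≡ C₂
  cocircuit-minimal l₁ l₂ C₁⊆C₂ =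
    let a , b , a≢b , a∈ , b∈ = two-points l₂
    in ∁-injective (unique a≢b l₁ (p⊆q⇒∁p⊇∁q C₁⊆C₂ a∈) (p⊆q⇒∁p⊇∁q C₁⊆C₂ b∈) l₂ a∈ b∈)

  module _ {C₁ C₂ e} (l₁ : Line (∁ C₁)) (l₂ : Line (∁ C₂)) (C₁≢C₂ : C₁ ≢ C₂) (e∈ : e ∈ C₁ ∩ C₂)
    where

    ∁⊆∪-e : ∀ {L} → e ∈ L → (∀ {x} → x ∈ ∁ C₁ → x ∈ ∁ C₂ → x ∈ L) → ∁ L ⊆ (C₁ ∪ C₂) - e
    ∁⊆∪-e {L} e∈L ∩⊆L {x} x∈∁L = x∈p∧x≢y⇒x∈p-y
      (decidable-stable (x ∈? C₁ ∪ C₂) λ x∉ →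
        x∈∁p⇒x∉p x∈∁L (∩⊆L (x∉p⇒x∈∁p (x∉ ∘ x∈p∪q⁺ ∘ inj₁)) (x∉p⇒x∈∁p (x∉ ∘ x∈p∪q⁺ ∘ inj₂))))
      λ x≡e → x∈∁p⇒x∉p x∈∁L (subst (_∈ L) (sym x≡e) e∈L)

    e≢ : ∀ {p} → p ∈ ∁ C₁ → p ≢ e
    e≢ p∈ refl = x∈∁p⇒x∉p p∈ (proj₁ (x∈p∩q⁻ C₁ C₂ e∈))

    -- In terms of lines, the task is to find a line through `e` containing the common points of two
    -- distinct lines. They share at most one point `p`. The line joining `p` and `e` works, and if
    -- they are disjoint any line through `e` does.
    cocircuit-elimination : ∃[ C₃ ] Line (∁ C₃) × C₃ ⊆ (C₁ ∪ C₂) - e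
    cocircuit-elimination with nonempty? (∁ C₁ ∩ ∁ C₂)
    ... | yes (p , p∈) =
      let p∈₁ , p∈₂ = x∈p∩q⁻ (∁ C₁) (∁ C₂) p∈
          L , l , p∈L , e∈L = through p e (e≢ p∈₁)
      in ∁ L , subst Line (sym (∁-involutive L)) l , ∁⊆∪-e e∈L λ {x} x∈₁ x∈₂ →
           subst (_∈ L) (decidable-stable (p Fin.≟ x) λ p≢x →
             C₁≢C₂ (∁-injective (unique p≢x l₁ p∈₁ x∈₁ l₂ p∈₂ x∈₂))) p∈L
    ... | no disjoint =
      let p , _ , _ , p∈₁ , _ = two-points l₁
          L , l , _ , e∈L = through p e (e≢ p∈₁)
      in ∁ L , subst Line (sym (∁-involutive L)) l , ∁⊆∪-e e∈L λ {x} x∈₁ x∈₂ →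
           contradiction (x , x∈p∩q⁺ (x∈₁ , x∈₂)) disjoint

  cocircuits : Matroid n
  cocircuits = record
    { Circuit     = Line ∘ ∁
    ; circuit?    = line? ∘ ∁
    ; nonempty    = proper ∘ subst Line ∁⊥≡⊤
    ; minimal     = cocircuit-minimal
    ; elimination = cocircuit-elimination
    }

-- The last two points called are on a unique line L, and ∁ L wins: it is
-- complete before them, and any other cocircuit contains one of them.

module _ {m} (𝓛 : LinearSpace (2 ℕ.+ m)) where
  open LinearSpace 𝓛

  private
    M = cocircuits 𝓛
    penultimate last : Fin (2 ℕ.+ m)
    penultimate = inject₁ (fromℕ m)
    last        = fromℕ (suc m)

  module _ {σ : Vec (Fin (2 ℕ.+ m)) (2 ℕ.+ m)} (σ-unique : Unique σ) where

    private
      a b : Fin (2 ℕ.+ m)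
      a = lookup σ penultimate
      b = lookup σ last

    toℕ-penultimate : toℕ penultimate ≡ m
    toℕ-penultimate = trans (toℕ-inject₁ (fromℕ m)) (toℕ-fromℕ m)

    toℕ-last : toℕ last ≡ suc m
    toℕ-last = toℕ-fromℕ (suc m)

    lookup-injective : ∀ {i j} → lookup σ i ≡ lookup σ j → i ≡ j
    lookup-injective = Vecᵤ.lookup-injective σ-unique _ _

    a≢b : a ≢ b
    a≢b a≡b = ℕ.<⇒≢ (ℕ.n<1+n m)
      (trans (sym toℕ-penultimate) (trans (cong toℕ (lookup-injective a≡b)) toℕ-last))

    late-∉-called : ∀ i {t} → t ℕ.≤ toℕ i → lookup σ i ∉ called σ t
    late-∉-called i {t} t≤i x∈ =
      let j , j<t , eq = ∈-called⁻ σ t x∈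
      in ℕ.<⇒≱ j<t (subst (λ k → t ℕ.≤ toℕ k) (sym (lookup-injective eq)) t≤i)

    a,b∉⇒⊆called : ∀ {S} → a ∉ S → b ∉ S → S ⊆ called σ m
    a,b∉⇒⊆called {S} a∉S b∉S {x} x∈S =
      let i , eq = injective⇒∃-preimage lookup-injective x
          i∈S = subst (_∈ S) (sym eq) x∈S
          i≢p : toℕ i ≢ m
          i≢p i≡p = a∉S (subst (λ k → lookup σ k ∈ S)
            (toℕ-injective (trans i≡p (sym toℕ-penultimate))) i∈S)
          i≢q : toℕ i ≢ suc m
          i≢q i≡q = b∉S (subst (λ k → lookup σ k ∈ S)
            (toℕ-injective (trans i≡q (sym toℕ-last))) i∈S)
          i<1+m = ℕ.≤∧≢⇒< (ℕ.≤-pred (toℕ<n i)) i≢q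
      in subst (_∈ called σ m) eq
           (∈-called⁺ σ m i (ℕ.≤∧≢⇒< (ℕ.≤-pred i<1+m) i≢p))

    -- Suppose `C` contained the point at position `i`. It could not be complete before that point
    -- is called, but by then the first `m` points already contain the complement of the line
    -- joining the last two.
    wins⇒late-∉ : ∀ {C} → Wins M C σ → ∀ i → m ℕ.≤ toℕ i → lookup σ i ∉ C
    wins⇒late-∉ {C} (t , C⊆ , ind) i m≤i i∈C with suc (toℕ t) ℕ.≤? toℕ i
    ... | yes t<i = late-∉-called i t<i (C⊆ i∈C)
    ... | no t≮i =
      let L , l , a∈L , b∈L = through a b a≢b
      in ind (∁ L , subst Line (sym (∁-involutive L)) l , λ x∈ →
           called-mono σ (ℕ.≤-trans m≤i (ℕ.≮⇒≥ t≮i))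
             (a,b∉⇒⊆called {∁ L} (x∈p⇒x∉∁p a∈L) (x∈p⇒x∉∁p b∈L) x∈))

    wins⇒∉ : ∀ {C} → Wins M C σ → a ∉ C × b ∉ C
    wins⇒∉ {C} wins =
      wins⇒late-∉ {C} wins penultimate (ℕ.≤-reflexive (sym toℕ-penultimate)) ,
      wins⇒late-∉ {C} wins last (ℕ.≤-trans (ℕ.n≤1+n m) (ℕ.≤-reflexive (sym toℕ-last)))

    -- Descent on `t` to the shortest prefix containing `C`, which is not the empty one. A circuit
    -- contained in a shorter prefix would also avoid the last two points, so its line is that of
    -- `C`.
    ⊆called⇒wins : ∀ {C} → Line (∁ C) → a ∉ C → b ∉ C → ∀ {t} → t ℕ.≤ m →
                   C ⊆ called σ t → Wins M C σ
    ⊆called⇒wins {C} l a∉C b∉C {zero} _ C⊆ =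
      let C≡⊥ = Empty-unique λ (x , x∈C) → ∉⊥ (C⊆ x∈C)
      in contradiction (subst (Line ∘ ∁) C≡⊥ l) (Matroid.nonempty M)
    ⊆called⇒wins {C} l a∉C b∉C {suc t} t<m C⊆ with C ⊆? called σ t
    ... | yes C⊆′ = ⊆called⇒wins l a∉C b∉C (ℕ.<⇒≤ t<m) C⊆′
    ... | no C⊈ =
      let t<2+m = ℕ.<-trans t<m (ℕ.<-trans (ℕ.n<1+n m) (ℕ.n<1+n (suc m)))
          t≡ = toℕ-fromℕ< t<2+m
      in fromℕ< t<2+m , subst (λ s → C ⊆ called σ (suc s)) (sym t≡) C⊆ ,
         λ (D , d , D⊆′) →
           let D⊆ = λ {x} → subst (λ s → D ⊆ called σ s) t≡ D⊆′ {x}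
               a∉D = late-∉-called penultimate
                 (ℕ.≤-trans (ℕ.<⇒≤ t<m) (ℕ.≤-reflexive (sym toℕ-penultimate))) ∘ D⊆
               b∉D = late-∉-called last
                 (ℕ.≤-trans (ℕ.<⇒≤ (ℕ.<-trans t<m (ℕ.n<1+n m))) (ℕ.≤-reflexive (sym toℕ-last))) ∘ D⊆
               C≡D = ∁-injective (unique a≢b l (x∉p⇒x∈∁p a∉C) (x∉p⇒x∈∁p b∉C)
                       d (x∉p⇒x∈∁p a∉D) (x∉p⇒x∈∁p b∉D))
           in C⊈ (subst (_⊆ called σ t) (sym C≡D) D⊆)

    ∉⇒wins : ∀ {C} → Line (∁ C) → a ∉ C → b ∉ C → Wins M C σ
    ∉⇒wins {C} l a∉C b∉C = ⊆called⇒wins l a∉C b∉C ℕ.≤-refl (a,b∉⇒⊆called {C} a∉C b∉C)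

  β-image : ∀ φ {C} → Line (∁ C) → Line (∁ (image φ C)) → β M C ≡ β M (image φ C)
  β-image φ {C} l φl = β-relabel M φ
    (λ {σ} σ-unique wins →
      let a∉ , b∉ = wins⇒∉ σ-unique {C} wins
      in ∉⇒wins (Vecᵤ.map⁺ (⟨$⟩ʳ-injective φ) σ-unique) φl
           (lookup-map-∉⁺ φ {C} {_} {σ} penultimate a∉) (lookup-map-∉⁺ φ {C} {_} {σ} last b∉))
    (λ {σ} σ-unique wins →
      let a∉ , b∉ = wins⇒∉ (Vecᵤ.map⁺ (⟨$⟩ʳ-injective φ) σ-unique) {image φ C} wins
      in ∉⇒wins σ-unique l
           (lookup-map-∉⁻ φ {C} {_} {σ} penultimate a∉) (lookup-map-∉⁻ φ {C} {_} {σ} last b∉))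

  cocircuits-equitable : (∀ {L L′} → Line L → Line L′ → ∣ L ∣ ≡ ∣ L′ ∣) → Equitable M
  cocircuits-equitable ∣line∣ {C₁} {C₂} l₁ l₂ =
    let φ , eq = ∣∣≡⇒∃-image C₁ C₂ (begin
          ∣ C₁ ∣                    ≡⟨ cong ∣_∣ (∁-involutive C₁) ⟨
          ∣ ∁ (∁ C₁) ∣              ≡⟨ ∣∁p∣≡n∸∣p∣ (∁ C₁) ⟩
          2 ℕ.+ m ℕ.∸ ∣ ∁ C₁ ∣      ≡⟨ cong (2 ℕ.+ m ℕ.∸_) (∣line∣ l₁ l₂) ⟩
          2 ℕ.+ m ℕ.∸ ∣ ∁ C₂ ∣      ≡⟨ ∣∁p∣≡n∸∣p∣ (∁ C₂) ⟨
          ∣ ∁ (∁ C₂) ∣              ≡⟨ cong ∣_∣ (∁-involutive C₂) ⟩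
          ∣ C₂ ∣                    ∎)
    in trans (β-image φ l₁ (subst (Line ∘ ∁) (sym eq) l₂)) (cong (β M) eq)
    where open ≡-Reasoning

-- Stated for variable n and m, because conversion checking at numerals unfolds
-- cocircuits and β.
equitable-nontransitive : ∀ {n m} (𝓛 : LinearSpace n) → n ≡ 2 ℕ.+ m →
  (∀ {L L′} → LinearSpace.Line 𝓛 L → LinearSpace.Line 𝓛 L′ → ∣ L ∣ ≡ ∣ L′ ∣) →
  ¬ CircuitTransitive (cocircuits 𝓛) →
  Σ[ n ∈ ℕ ] Σ[ M ∈ Matroid n ] Equitable M × ¬ CircuitTransitive M
equitable-nontransitive 𝓛 refl ∣line∣ nontransitive =
  _ , cocircuits 𝓛 , (λ {C₁} {C₂} → cocircuits-equitable 𝓛 ∣line∣ {C₁} {C₂}) , nontransitive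

-- The translates modulo 13 of {0,1,4} and {0,2,7}, with the Pasch configuration
-- 014, 027, 179, 249 traded for 017, 024, 149, 279.

triple : Fin 13 → Fin 13 → Fin 13 → Subset 13
triple a b c = ⁅ a ⁆ ∪ ⁅ b ⁆ ∪ ⁅ c ⁆

triples : List (Subset 13)
triples =
  triple (# 0) (# 1) (# 7) ∷ triple (# 0) (# 2) (# 4) ∷
  triple (# 0) (# 3) (# 12) ∷ triple (# 0) (# 5) (# 11) ∷
  triple (# 0) (# 6) (# 8) ∷ triple (# 0) (# 9) (# 10) ∷
  triple (# 1) (# 2) (# 5) ∷ triple (# 1) (# 3) (# 8) ∷
  triple (# 1) (# 4) (# 9) ∷ triple (# 1) (# 6) (# 12) ∷
  triple (# 1) (# 10) (# 11) ∷ triple (# 2) (# 3) (# 6) ∷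
  triple (# 2) (# 7) (# 9) ∷ triple (# 2) (# 8) (# 10) ∷
  triple (# 2) (# 11) (# 12) ∷ triple (# 3) (# 4) (# 7) ∷
  triple (# 3) (# 5) (# 10) ∷ triple (# 3) (# 9) (# 11) ∷
  triple (# 4) (# 5) (# 8) ∷ triple (# 4) (# 6) (# 11) ∷
  triple (# 4) (# 10) (# 12) ∷ triple (# 5) (# 6) (# 9) ∷
  triple (# 5) (# 7) (# 12) ∷ triple (# 6) (# 7) (# 10) ∷
  triple (# 7) (# 8) (# 11) ∷ triple (# 8) (# 9) (# 12) ∷ []

_≟ˢ_ : DecidableEquality (Subset n)
_≟ˢ_ = ≡-dec Bool._≟_

triples-proper : All (λ L → L ≢ ⊤) triples
triples-proper = from-yes (All.all? (λ L → ¬? (L ≟ˢ ⊤)) triples)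

triples-two-points : All (λ L → ∃[ a ] ∃[ b ] a ≢ b × a ∈ L × b ∈ L) triples
triples-two-points = from-yes (All.all? (λ L → any? λ a → any? λ b →
  ¬? (a Fin.≟ b) ×-dec a ∈? L ×-dec b ∈? L) triples)

triples-through : ∀ a b → Any (λ L → a ∈ L × b ∈ L) triples
triples-through = from-yes (all? λ a → all? λ b →
  Any.any? (λ L → a ∈? L ×-dec b ∈? L) triples)

-- Uniqueness of the joining line in a form that a finite computation over pairs of triples can
-- check.
triples-meet : All (λ L → All (λ L′ → L ≡ L′ ⊎ ∣ L ∩ L′ ∣ ℕ.≤ 1) triples) triples
triples-meet = from-yes (All.all? (λ L → All.all? (λ L′ →
  L ≟ˢ L′ ⊎-dec ∣ L ∩ L′ ∣ ℕ.≤? 1) triples) triples)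

∣triple∣ : All (λ L → ∣ L ∣ ≡ 3) triples
∣triple∣ = from-yes (All.all? (λ L → ∣ L ∣ ℕ.≟ 3) triples)

steiner : LinearSpace 13
steiner = record
  { Line       = List._∈ triples
  ; line?      = λ L → Any.any? (L ≟ˢ_) triples
  ; proper     = λ ⊤∈ → All.lookup triples-proper ⊤∈ refl
  ; two-points = All.lookup triples-two-points
  ; through    = λ a b _ → find (triples-through a b)
  ; unique     = λ {a} {b} {L} {L′} a≢b l a∈L b∈L l′ a∈L′ b∈L′ →
      case All.lookup (All.lookup triples-meet l) l′ of λ where
        (inj₁ L≡L′)    → L≡L′
        (inj₂ ∣L∩L′∣≤1) → contradiction
          (∈₂⇒2≤∣∣ a≢b (x∈p∩q⁺ (a∈L , a∈L′)) (x∈p∩q⁺ (b∈L , b∈L′))) (ℕ.≤⇒≯ ∣L∩L′∣≤1)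
  }

-- A Pasch configuration: three lines with six points in all, and a fourth line
-- among these points.

record Pasch (C D₁ D₂ D₃ : Subset 13) : Set where
  field
    triangle : ∣ C ∩ D₁ ∩ D₂ ∣ ≡ 7
    fourth   : C ∩ D₁ ∩ D₂ ⊆ D₃
    ≢C       : D₃ ≢ C
    ≢D₁      : D₃ ≢ D₁
    ≢D₂      : D₃ ≢ D₂

image-∩₃ : ∀ (φ : Permutation′ n) S T R →
           image φ (S ∩ T ∩ R) ≡ image φ S ∩ image φ T ∩ image φ R
image-∩₃ φ S T R = trans (image-∩ φ S (T ∩ R)) (cong (image φ S ∩_) (image-∩ φ T R))

Pasch-image : ∀ φ {C D₁ D₂ D₃} → Pasch C D₁ D₂ D₃ →
              Pasch (image φ C) (image φ D₁) (image φ D₂) (image φ D₃)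
Pasch-image φ {C} {D₁} {D₂} {D₃} pasch = record
  { triangle = trans (cong ∣_∣ (sym (image-∩₃ φ C D₁ D₂)))
                     (trans (∣image∣ φ (C ∩ D₁ ∩ D₂)) triangle)
  ; fourth   = subst (_⊆ image φ D₃) (image-∩₃ φ C D₁ D₂)
                     (image-⊆⁺ φ {C ∩ D₁ ∩ D₂} {D₃} fourth)
  ; ≢C       = ≢C ∘ image-injective φ {D₃} {C}
  ; ≢D₁      = ≢D₁ ∘ image-injective φ {D₃} {D₁}
  ; ≢D₂      = ≢D₂ ∘ image-injective φ {D₃} {D₂}
  }
  where open Pasch pasch

HasPasch : Matroid 13 → Subset 13 → Set
HasPasch M C = ∃[ D₁ ] ∃[ D₂ ] ∃[ D₃ ]
  Circuit D₁ × Circuit D₂ × Circuit D₃ × Pasch C D₁ D₂ D₃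
  where open Matroid M

HasPasch-image : ∀ {M φ} → IsAutomorphism M φ → ∀ {C} → HasPasch M C → HasPasch M (image φ C)
HasPasch-image {φ = φ} aut {C} (D₁ , D₂ , D₃ , d₁ , d₂ , d₃ , pasch) =
  image φ D₁ , image φ D₂ , image φ D₃ , preserves d₁ , preserves d₂ , preserves d₃ ,
  Pasch-image φ {C} {D₁} {D₂} {D₃} pasch
  where open IsAutomorphism aut

HasPasch-transitive : ∀ {M} → CircuitTransitive M → ∀ {C₁ C₂} →
  Matroid.Circuit M C₁ → Matroid.Circuit M C₂ → HasPasch M C₁ → HasPasch M C₂
HasPasch-transitive {M} transitive c₁ c₂ pasch =
  let φ , aut , eq = transitive c₁ c₂ in subst (HasPasch M) eq (HasPasch-image aut pasch)

-- The search runs over a finite list of lines, whereas `HasPasch` ranges over circuits, hence the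
-- complements. The intersection is the complement of the union of three lines, and 7 = 13 - 6 says
-- that this union has six points.
PaschFree : List (Subset 13) → Subset 13 → Set
PaschFree Ls C = All (λ L₁ → All (λ L₂ → ∣ C ∩ ∁ L₁ ∩ ∁ L₂ ∣ ≡ 7 →
  All (λ L₃ → C ∩ ∁ L₁ ∩ ∁ L₂ ⊆ ∁ L₃ → L₃ ≡ ∁ C ⊎ L₃ ≡ L₁ ⊎ L₃ ≡ L₂) Ls) Ls) Ls

paschFree? : ∀ Ls C → Dec (PaschFree Ls C)
paschFree? Ls C =
  All.all? (λ L₁ → All.all? (λ L₂ → (∣ C ∩ ∁ L₁ ∩ ∁ L₂ ∣ ℕ.≟ 7) →-dec
    All.all? (λ L₃ → (C ∩ ∁ L₁ ∩ ∁ L₂ ⊆? ∁ L₃) →-dec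
      (L₃ ≟ˢ ∁ C ⊎-dec L₃ ≟ˢ L₁ ⊎-dec L₃ ≟ˢ L₂)) Ls) Ls) Ls

PaschFree⇒¬HasPasch : ∀ {M Ls C} → (∀ {D} → Matroid.Circuit M D → ∁ D List.∈ Ls) →
                      PaschFree Ls C → ¬ HasPasch M C
PaschFree⇒¬HasPasch {C = C} line free (D₁ , D₂ , D₃ , d₁ , d₂ , d₃ , pasch) =
  case
    All.lookup
      (All.lookup (All.lookup free (line d₁)) (line d₂)
        (subst (λ S → ∣ S ∣ ≡ 7) (sym ∩≡) triangle))
      (line d₃)
      (subst₂ _⊆_ (sym ∩≡) (sym (∁-involutive D₃)) fourth)
  of λ where
    (inj₁ eq)        → ≢C (∁-injective eq)
    (inj₂ (inj₁ eq)) → ≢D₁ (∁-injective eq)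
    (inj₂ (inj₂ eq)) → ≢D₂ (∁-injective eq)
  where
  open Pasch pasch
  ∩≡ : C ∩ ∁ (∁ D₁) ∩ ∁ (∁ D₂) ≡ C ∩ D₁ ∩ D₂
  ∩≡ = cong₂ (λ S T → C ∩ S ∩ T) (∁-involutive D₁) (∁-involutive D₂)

-- Two cocircuits that no automorphism can match

S₁₃* : Matroid 13
S₁₃* = cocircuits steiner

open Matroid S₁₃* using (Circuit; circuit?)

-- The first four come from the configuration brought in by the trade. The triple 236 is 014 shifted
-- by 2. The same shift of the removed configuration contained 236 but also 249, which the trade
-- deleted.
C₁₄₉ C₀₁₇ C₀₂₄ C₂₇₉ C₂₃₆ : Subset 13
C₁₄₉ = ∁ (triple (# 1) (# 4) (# 9))
C₀₁₇ = ∁ (triple (# 0) (# 1) (# 7))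
C₀₂₄ = ∁ (triple (# 0) (# 2) (# 4))
C₂₇₉ = ∁ (triple (# 2) (# 7) (# 9))
C₂₃₆ = ∁ (triple (# 2) (# 3) (# 6))

C₁₄₉-hasPasch : HasPasch S₁₃* C₁₄₉
C₁₄₉-hasPasch = C₀₁₇ , C₀₂₄ , C₂₇₉ ,
  from-yes (circuit? C₀₁₇) , from-yes (circuit? C₀₂₄) , from-yes (circuit? C₂₇₉) ,
  record
    { triangle = refl
    ; fourth   = from-yes (C₁₄₉ ∩ C₀₁₇ ∩ C₀₂₄ ⊆? C₂₇₉)
    ; ≢C       = λ ()
    ; ≢D₁      = λ ()
    ; ≢D₂      = λ ()
    }

S₁₃*-not-transitive : ¬ CircuitTransitive (cocircuits steiner)
-- The identity suffices here because a circuit of `cocircuits steiner` is by definition a set whose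
-- complement is in `triples`.
S₁₃*-not-transitive transitive = (PaschFree⇒¬HasPasch {S₁₃*} {triples} {C₂₃₆} (λ c → c)
    (from-yes (paschFree? triples C₂₃₆)))
  (HasPasch-transitive {S₁₃*} transitive {C₁₄₉} {C₂₃₆}
    (from-yes (circuit? C₁₄₉)) (from-yes (circuit? C₂₃₆)) C₁₄₉-hasPasch)

∃-equitable-nontransitive : Σ[ n ∈ ℕ ] Σ[ M ∈ Matroid n ] Equitable M × ¬ CircuitTransitive M
∃-equitable-nontransitive = equitable-nontransitive steiner refl
  (λ l l′ → trans (All.lookup ∣triple∣ l) (sym (All.lookup ∣triple∣ l′)))
  S₁₃*-not-transitive

theorem9 : ∀ {c ℓ} →
    ( (∀ {n} (M : Matroid n) {C₁ C₂ : Subset n} →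
    Matroid.Circuit M C₁ → Matroid.Circuit M C₂ →
    (φ : Permutation′ n) → IsAutomorphism M φ → image φ C₁ ≡ C₂ →
    β M C₁ ≡ β M C₂)
    × (∀ {n} (M : Matroid n) → CircuitTransitive M → Equitable M) )
    ×
    (Σ[ n ∈ ℕ ] Σ[ M ∈ Matroid n ] Equitable M × ¬ CircuitTransitive M)
    ×
    ( (∀ r n → Equitable (U r n))
    × (∀ {q} (F : FiniteField q c ℓ) (n : ℕ) {N} (M M* : Matroid N) →
    IsProjectiveGeometry F n M → IsDual M M* → Equitable M*) )
theorem9 =
  ((λ M _ _ → automorphism⇒β M) , transitive⇒equitable) ,
  ∃-equitable-nontransitive ,
  uniform-equitable ,
  λ F n M M* pg dual {C₁} {C₂} → PG.dual-equitable F n pg M* dual {C₁} {C₂}
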